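{- There is a polynomial-time algorithm that, given a connected graph $G$ with a fixed vertex $\top$ and a pair $X,Y$ of acyclic $c$-orientations of $G$ (for the same $c$), outputs a shortest vertex flip sequence transforming $X$ into $Y$.
   Context: Graphs are finite and undirected. For a graph $G$, fix for each cycle $C$ of $G$ an arbitrary direction of traversal. Given an assignment $c$ of a number $c(C)\in\mathbb{N}_0$ to each cycle $C$ of $G$, a $c$-orientation of $G$ is an orientation of the edges of $G$ having, for every cycle $C$ of $G$, exactly $c(C)$ edges of $C$ oriented in forward direction. Thus $X,Y$ are $c$-orientations for a common $c$ if and only if each cycle of $G$ has equally many forward edges in $X$ and in $Y$. An orientation is acyclic if it has no directed cycle. A vertex flip (with respect to the fixed vertex $\top$) in an orientation consists of choosing a vertex $v\neq\top$ that is a source or a sink of the current orientation and reversing all edges incident to $v$; this again yields a $c$-orientation. A vertex flip sequence transforming $X$ into $Y$ is a sequence of successive vertex flips starting at $X$ and ending at $Y$; its length is the number of flips, and a shortest one is one of minimum length. -}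

module Defs where

open import Data.Bool using (Bool; true; false; not; if_then_else_)
import Data.Bool.Properties as Bool
open import Data.Fin using (Fin; toℕ)
import Data.Fin.Properties as Fin
open import Data.List using (List; []; _∷_; length; map; filter)
import Data.List as List
open import Data.List.Relation.Binary.Permutation.Propositional using (_↭_)
open import Data.List.Relation.Unary.All using (All)
open import Data.List.Relation.Unary.Unique.Propositional using (Unique)
open import Data.Nat using (ℕ; zero; suc; _+_; _∸_; _≤_; _≟_)
open import Data.Product using (Σ; _×_; _,_; proj₁; proj₂; map₂)
open import Data.Sum using (_⊎_)
open import Data.Vec using (Vec; lookup; tabulate; toList)
import Data.Vec as Vec
open import Relation.Binary.Construct.Closure.ReflexiveTransitive using (Star; ε; _◅_)
open import Relation.Binary.PropositionalEquality using (_≡_; _≢_)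
open import Relation.Nullary using (Dec; yes; no; ¬_; does)
open import Relation.Nullary.Decidable using (_⊎-dec_)

-- A graph on the vertices Fin n with edges Fin m, given by the two ends of
-- each edge.  Parallel edges and loops are allowed.  The order in which the
-- two ends are listed has no graph-theoretic meaning; it only serves to name
-- the two directions of an edge.

Graph : ℕ → ℕ → Set
Graph n m = Vec (Fin n × Fin n) m

-- An edge together with one of its two directions; `true` is the direction
-- from the first listed end to the second.

Dart : ℕ → Set
Dart m = Fin m × Bool

reverseDart : ∀ {m} → Dart m → Dart m
reverseDart = map₂ not

module _ {n m : ℕ} (G : Graph n m) where

  source target : Dart m → Fin n
  source (e , true)  = proj₁ (lookup G e)
  source (e , false) = proj₂ (lookup G e)
  target d = source (reverseDart d)

  Step : Fin n → Fin n → Set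
  Step u v = Σ (Dart m) λ d → source d ≡ u × target d ≡ v

  Walk : Fin n → Fin n → Set
  Walk = Star Step

  Connected : Set
  Connected = ∀ u v → Walk u v

module _ {n m : ℕ} {G : Graph n m} where

  walkDarts : ∀ {u v} → Walk G u v → List (Dart m)
  walkDarts ε             = []
  walkDarts ((d , _) ◅ w) = d ∷ walkDarts w

-- A cycle together with a base point and a direction of traversal.
-- Distinctness of the edges only matters for cycles of length two: it
-- excludes going back along the same edge.

record Cycle {n m : ℕ} (G : Graph n m) : Set where
  field
    {base next}   : Fin n
    first         : Step G base next
    rest          : Walk G next base

  darts : List (Dart m)
  darts = walkDarts (first ◅ rest)

  field
    distinctVertices : Unique (map (source G) darts)
    distinctEdges    : Unique (map proj₁ darts)

open Cycle public using (darts)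

-- Two traversals of one and the same (undirected) cycle: they agree up to
-- base point, or up to base point and direction.

SameCycle : ∀ {n m} {G : Graph n m} → Cycle G → Cycle G → Set
SameCycle C D = darts C ↭ darts D ⊎ darts C ↭ map reverseDart (darts D)

-- A fixed, arbitrary direction of traversal for each cycle.

record Directions {n m : ℕ} (G : Graph n m) : Set where
  field
    direct   : Cycle G → Cycle G
    same     : ∀ C → SameCycle (direct C) C
    -- The direction depends on the undirected cycle only.
    coherent : ∀ C D → SameCycle C D → darts (direct C) ↭ darts (direct D)

open Directions public

-- The direction given to each edge.

Orientation : ℕ → Set
Orientation m = Vec Bool m

Forward : ∀ {m} → Orientation m → Dart m → Set
Forward X (e , b) = lookup X e ≡ b

forward? : ∀ {m} (X : Orientation m) (d : Dart m) → Dec (Forward X d)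
forward? X (e , b) = lookup X e Bool.≟ b

module _ {n m : ℕ} {G : Graph n m} where

  forwardEdges : Orientation m → Cycle G → ℕ
  forwardEdges X C = length (filter (forward? X) (darts C))

  IsCOrientation : Directions G → (Cycle G → ℕ) → Orientation m → Set
  IsCOrientation δ c X = ∀ C → forwardEdges X (direct δ C) ≡ c C

module _ {n m : ℕ} (G : Graph n m) where

  Acyclic : Orientation m → Set
  Acyclic X = ∀ (C : Cycle G) → ¬ All (Forward X) (darts C)

  tail head : Orientation m → Fin m → Fin n
  tail X e = source G (e , lookup X e)
  head X e = target G (e , lookup X e)

  IsSource IsSink : Orientation m → Fin n → Set
  IsSource X v = ∀ e → head X e ≢ v
  IsSink   X v = ∀ e → tail X e ≢ v

  Incident : Fin m → Fin n → Set
  Incident e v = proj₁ (lookup G e) ≡ v ⊎ proj₂ (lookup G e) ≡ v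

  incident? : ∀ e v → Dec (Incident e v)
  incident? e v = (proj₁ (lookup G e) Fin.≟ v) ⊎-dec (proj₂ (lookup G e) Fin.≟ v)

  reverseAt : Fin n → Orientation m → Orientation m
  reverseAt v X = tabulate λ e →
    if does (incident? e v) then not (lookup X e) else lookup X e

  module _ (top : Fin n) where

    Flippable : Orientation m → Fin n → Set
    Flippable X v = v ≢ top × (IsSource X v ⊎ IsSink X v)

    -- A flip sequence is recorded by the vertices that are flipped, in order.

    data FlipSequence (Y : Orientation m) : Orientation m → List (Fin n) → Set where
      []  : FlipSequence Y Y []
      _∷_ : ∀ {X v vs} → Flippable X v → FlipSequence Y (reverseAt v X) vs →
            FlipSequence Y X (v ∷ vs)

    IsShortestFlipSequence : Orientation m → Orientation m → List (Fin n) → Set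
    IsShortestFlipSequence X Y vs =
      FlipSequence Y X vs × (∀ ws → FlipSequence Y X ws → length vs ≤ length ws)

-- Machine model: structured programs for a random access machine with
-- unit cost.  The store consists of arrays; the array accessed is fixed in the
-- program text, the index is computed.  As a program mentions finitely many
-- arrays, interleaving them gives the usual single memory.  The only
-- arithmetic is addition and truncated subtraction, so the bit length of
-- values grows by at most a constant per step, and polynomial time in this
-- model is polynomial time on Turing machines; unit-cost multiplication would
-- destroy this.

data Expr : Set where
  lit     : ℕ → Expr
  _[_]    : ℕ → Expr → Expr
  _⊕_ _⊖_ : Expr → Expr → Expr

data Program : Set where
  skip           : Program
  _[_]≔_         : ℕ → Expr → Expr → Program
  _⨾_            : Program → Program → Program
  if_then_else′_ : Expr → Program → Program → Program
  while_loop_    : Expr → Program → Program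

infix  8 _[_]
infixl 6 _⊕_ _⊖_
infix  5 _[_]≔_
infix  4 if_then_else′_ while_loop_
infixr 3 _⨾_

Store : Set
Store = ℕ → ℕ → ℕ

eval : Store → Expr → ℕ
eval s (lit k)   = k
eval s (a [ i ]) = s a (eval s i)
eval s (x ⊕ y)   = eval s x + eval s y
eval s (x ⊖ y)   = eval s x ∸ eval s y

cost : Expr → ℕ
cost (lit k)   = 1
cost (a [ i ]) = suc (cost i)
cost (x ⊕ y)   = suc (cost x + cost y)
cost (x ⊖ y)   = suc (cost x + cost y)

write : Store → ℕ → ℕ → ℕ → Store
write s a i x b j with a ≟ b | i ≟ j
... | yes _ | yes _ = x
... | _     | _     = s b j

-- ⟨ p , s ⟩⇓⟨ s′ , t ⟩: started in the store s, the program p halts in the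
-- store s′ after t steps.  A condition holds if its value is nonzero.

data ⟨_,_⟩⇓⟨_,_⟩ : Program → Store → Store → ℕ → Set where
  skip       : ∀ {s} → ⟨ skip , s ⟩⇓⟨ s , 1 ⟩
  assign     : ∀ {s a i x} →
               ⟨ a [ i ]≔ x , s ⟩⇓⟨ write s a (eval s i) (eval s x) , suc (cost i + cost x) ⟩
  seq        : ∀ {p q s s′ s″ t u} →
               ⟨ p , s ⟩⇓⟨ s′ , t ⟩ → ⟨ q , s′ ⟩⇓⟨ s″ , u ⟩ →
               ⟨ p ⨾ q , s ⟩⇓⟨ s″ , t + u ⟩
  if-true    : ∀ {b p q s s′ t} → eval s b ≢ 0 → ⟨ p , s ⟩⇓⟨ s′ , t ⟩ →
               ⟨ if b then p else′ q , s ⟩⇓⟨ s′ , suc (cost b + t) ⟩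
  if-false   : ∀ {b p q s s′ t} → eval s b ≡ 0 → ⟨ q , s ⟩⇓⟨ s′ , t ⟩ →
               ⟨ if b then p else′ q , s ⟩⇓⟨ s′ , suc (cost b + t) ⟩
  while-true : ∀ {b p s s′ s″ t u} → eval s b ≢ 0 →
               ⟨ p , s ⟩⇓⟨ s′ , t ⟩ → ⟨ while b loop p , s′ ⟩⇓⟨ s″ , u ⟩ →
               ⟨ while b loop p , s ⟩⇓⟨ s″ , suc (cost b + t + u) ⟩
  while-done : ∀ {b p s} → eval s b ≡ 0 →
               ⟨ while b loop p , s ⟩⇓⟨ s , suc (cost b) ⟩

array : List ℕ → ℕ → ℕ
array []       _       = 0
array (x ∷ xs) zero    = x
array (x ∷ xs) (suc i) = array xs i

bit : Bool → ℕ
bit b = if b then 1 else 0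

-- The input: the sizes and the fixed vertex, the list of edges, and the two
-- orientations.  All other cells are zero.

input : ∀ {n m} → Graph n m → Fin n → Orientation m → Orientation m → Store
input {n} {m} G top X Y = λ where
  0 → array (n ∷ m ∷ toℕ top ∷ [])
  1 → array (toList (Vec.map (λ e → toℕ (proj₁ e)) G))
  2 → array (toList (Vec.map (λ e → toℕ (proj₂ e)) G))
  3 → array (toList (Vec.map bit X))
  4 → array (toList (Vec.map bit Y))
  _ → λ _ → 0

-- The output is read from array 5: the length of the list, then its entries.

Outputs : ∀ {n} → Store → List (Fin n) → Set
Outputs s vs = s 5 0 ≡ length vs
             × (∀ i → s 5 (suc (toℕ i)) ≡ toℕ (List.lookup vs i))

module Submission where

-- Flipping a source v lowers a height h v by one, flipping a sink raises it, and the edges of X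
-- that Y reverses are exactly those along which h drops by one.  Hence h is determined up to a
-- constant by X and Y, at least ∑ |h v - h top| flips are needed, and conversely any flip that
-- moves h v towards h top is part of a shortest sequence.  Such flips exist as long as h is not
-- constant: from a vertex above top, walking backwards along the edges never decreases h and ends
-- at a source by acyclicity; symmetrically for vertices below top.
-- The heights exist because X and Y have equally many forward edges on every cycle.  They are
-- computed by raising, from zero, one end of a violated edge by one: this never exceeds
-- a given non-negative solution, which yields the polynomial bound.

open import Defs
import Algebra.Properties.AbelianGroup
open import Data.Bool using (Bool; true; false; not; if_then_else_; _∨_)
import Data.Bool.Properties as Bool
open import Data.Empty using (⊥-elim)
open import Data.Fin using (Fin; zero; suc; toℕ; fromℕ<)
import Data.Fin.Properties as Fin
open import Data.Integer as ℤ using (ℤ; +_; -[1+_])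
import Data.Integer.Properties as ℤ
import Data.Integer.Tactic.RingSolver as ℤSolver
open import Data.List using (List; []; _∷_; _++_; _∷ʳ_; length; map; filter)
import Data.List as List
import Data.List.Properties as List
open import Data.List.Membership.Propositional using (_∈_)
import Data.List.Membership.DecPropositional as DecMembership
open import Data.List.Membership.Propositional.Properties using (∈-lookup)
open import Data.List.Relation.Binary.Permutation.Propositional using (_↭_)
open import Data.List.Relation.Binary.Permutation.Propositional.Properties using (filter-↭; ↭-length)
open import Data.List.Relation.Unary.All as All using (All; []; _∷_)
import Data.List.Relation.Unary.All.Properties as All
open import Data.List.Relation.Unary.AllPairs using ([]; _∷_)
open import Data.List.Relation.Unary.Any using (here; there)
open import Data.List.Relation.Unary.Unique.Propositional using (Unique)
open import Data.Nat as ℕ using (ℕ; zero; suc; _+_; _*_; _∸_; _^_; _≤_; _<_; z≤n; s≤s; _⊔_; ∣_-_∣)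
import Data.Nat.Properties as ℕ
import Data.Nat.Tactic.RingSolver as ℕSolver
open import Data.Product using (∃-syntax; Σ-syntax; _×_; _,_; proj₁; proj₂)
open import Data.Sum using (_⊎_; inj₁; inj₂)
open import Data.Unit using (⊤; tt)
open import Data.Vec using (Vec; lookup; tabulate; toList; []; _∷_)
import Data.Vec as Vec
open import Data.Vec.Functional using (foldr)
import Data.Vec.Properties as Vec
open import Function using (_∘_; case_of_)
open import Relation.Binary.Construct.Closure.ReflexiveTransitive using (ε; _◅_; _◅◅_)
open import Relation.Binary.Definitions using (Tri; tri<; tri≈; tri>)
open import Relation.Binary.PropositionalEquality using (_≡_; _≢_; refl; sym; trans; cong; cong₂; subst; module ≡-Reasoning)
open import Relation.Nullary using (Dec; yes; no; ¬_; contradiction; does)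

-- The direction of an edge in the current orientation can be read off from the heights and Y, so
-- the program changes one height per flip and never stores an intermediate orientation. The lower
-- bound holds for every flip sequence because top is never flipped: a flip changes a single
-- difference to h top, and by one. The greedy flips attain it because the walk stays strictly on
-- its side of top, hence ends at a vertex other than top whose flip brings it nearer. Acyclicity of
-- the intermediate orientations is not carried along: each of them descends in the potential
-- (height, rank in Y), which also bounds the length of the walks. As the store holds natural
-- numbers, the integer potentials, of absolute value at most n because they are taken along simple
-- paths, are shifted by n. This is the origin of n + n: it bounds the given solution, therefore the
-- heights computed below that solution, and flips preserve it since they move heights towards h
-- top.

-- Walks

module ℤGroup = Algebra.Properties.AbelianGroup ℤ.+-0-abelianGroup

unique⇒lookup-injective : ∀ {A : Set} {xs : List A} → Unique xs →
                          ∀ {i j} → List.lookup xs i ≡ List.lookup xs j → i ≡ j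
unique⇒lookup-injective (x≢ ∷ u) {zero}  {zero}  eq = refl
unique⇒lookup-injective (x≢ ∷ u) {zero}  {suc j} eq = contradiction eq (All.lookup x≢ (∈-lookup j))
unique⇒lookup-injective (x≢ ∷ u) {suc i} {zero}  eq = contradiction (sym eq) (All.lookup x≢ (∈-lookup i))
unique⇒lookup-injective (x≢ ∷ u) {suc i} {suc j} eq = cong suc (unique⇒lookup-injective u eq)

unique⇒length≤ : ∀ {n} {xs : List (Fin n)} → Unique xs → length xs ≤ n
unique⇒length≤ u = Fin.injective⇒≤ (unique⇒lookup-injective u)

sameEdge : ∀ {m} (d d′ : Dart m) → proj₁ d ≡ proj₁ d′ → d ≡ d′ ⊎ d′ ≡ reverseDart d
sameEdge (e , true)  (_ , true)  refl = inj₁ refl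
sameEdge (e , true)  (_ , false) refl = inj₂ refl
sameEdge (e , false) (_ , true)  refl = inj₂ refl
sameEdge (e , false) (_ , false) refl = inj₁ refl

module _ {n m : ℕ} {G : Graph n m} where

  source-target : ∀ d → source G d ≡ target G (reverseDart d)
  source-target (_ , true)  = refl
  source-target (_ , false) = refl

  visits : ∀ {u v} → Walk G u v → List (Fin n)
  visits {u} ε       = u ∷ []
  visits {u} (_ ◅ w) = u ∷ visits w

  length-visits : ∀ {u v} (w : Walk G u v) → length (visits w) ≡ suc (length (walkDarts w))
  length-visits ε       = refl
  length-visits (_ ◅ w) = cong suc (length-visits w)

  start∈visits : ∀ {u v} (w : Walk G u v) → u ∈ visits w
  start∈visits ε       = here refl
  start∈visits (_ ◅ w) = here refl

  end∈visits : ∀ {u v} (w : Walk G u v) → v ∈ visits w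
  end∈visits ε       = here refl
  end∈visits (_ ◅ w) = there (end∈visits w)

  ends∈visits : ∀ {u v} (w : Walk G u v) →
                All (λ d → source G d ∈ visits w × target G d ∈ visits w) (walkDarts w)
  ends∈visits ε = []
  ends∈visits ((d , refl , refl) ◅ w) =
    (here refl , there (start∈visits w)) ∷
    All.map (λ (p , q) → there p , there q) (ends∈visits w)

  simple⇒uniqueSources : ∀ {u v} (w : Walk G u v) → Unique (visits w) →
                         Unique (map (source G) (walkDarts w))
  simple⇒uniqueSources ε _ = []
  simple⇒uniqueSources ((d , refl , _) ◅ w) (u≢ ∷ uniq) =
    All.map⁺ (All.map (λ (p , _) → All.lookup u≢ p) (ends∈visits w)) ∷ simple⇒uniqueSources w uniq

  end≢sources : ∀ {u v} (w : Walk G u v) → Unique (visits w) →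
                All (v ≢_) (map (source G) (walkDarts w))
  end≢sources ε _ = []
  end≢sources ((d , refl , _) ◅ w) (u≢ ∷ uniq) =
    (λ v≡u → All.lookup u≢ (end∈visits w) (sym v≡u)) ∷ end≢sources w uniq

  -- Two darts on the same edge have the same two ends.
  avoidedEdge : ∀ {u v} (w : Walk G u v) (d : Dart m) →
                ¬ (source G d ∈ visits w × target G d ∈ visits w) →
                All (proj₁ d ≢_) (map proj₁ (walkDarts w))
  avoidedEdge w d avoids = All.map⁺ (All.map (λ {d′} → new {d′}) (ends∈visits w))
    where
    new : ∀ {d′} → source G d′ ∈ visits w × target G d′ ∈ visits w → proj₁ d ≢ proj₁ d′
    new {d′} (s∈ , t∈) eq with sameEdge d′ d (sym eq)
    ... | inj₁ refl = avoids (s∈ , t∈)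
    ... | inj₂ refl = avoids (t∈ , subst (_∈ visits w) (source-target d′) s∈)

  simple⇒uniqueEdges : ∀ {u v} (w : Walk G u v) → Unique (visits w) →
                       Unique (map proj₁ (walkDarts w))
  simple⇒uniqueEdges ε _ = []
  simple⇒uniqueEdges ((d , refl , _) ◅ w) (u≢ ∷ uniq) =
    avoidedEdge w d (λ (s∈ , _) → All.lookup u≢ s∈ refl) ∷ simple⇒uniqueEdges w uniq

  -- The closing edge joins the two ends of the path, and no edge of a simple path with at least two
  -- darts does so. With one dart, the closing dart may be its reverse; this closed walk is not a
  -- cycle and has to be treated apart by every user of the lemma. With none, the closing edge is a
  -- loop.
  closingEdge : ∀ {u v} (w : Walk G u v) → Unique (visits w) → ((d , _) : Step G v u) →
                All (proj₁ d ≢_) (map proj₁ (walkDarts w)) ⊎ walkDarts w ≡ reverseDart d ∷ []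
  closingEdge ε _ _ = inj₁ []
  closingEdge ((d₁ , s₁ , _) ◅ ε) (u≢ ∷ _) (d , s≡v , _) with proj₁ d Fin.≟ proj₁ d₁
  ... | no  e≢ = inj₁ (e≢ ∷ [])
  ... | yes e≡ with sameEdge d d₁ e≡
  ...   | inj₁ refl = contradiction (trans (sym s₁) s≡v) (All.lookup u≢ (here refl))
  ...   | inj₂ refl = inj₂ refl
  closingEdge ((d₁ , s₁ , t₁) ◅ w@((d₂ , _) ◅ w′)) (u≢ ∷ x≢ ∷ _) (d , s≡v , t≡u) =
    inj₁ (e≢ ∷ avoidedEdge w d (λ (_ , t∈) → All.lookup u≢ t∈ (sym t≡u)))
    where
    e≢ : proj₁ d ≢ proj₁ d₁
    e≢ e≡ with sameEdge d d₁ e≡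
    ... | inj₁ refl = All.lookup u≢ (there (end∈visits w′)) (trans (sym s₁) s≡v)
    ... | inj₂ refl = All.lookup x≢ (end∈visits w′)
      (trans (sym t₁) (trans (sym (source-target d)) s≡v))

  closeCycle : ∀ {u v} (w : Walk G u v) → Unique (visits w) → (s : Step G v u) →
               (Σ[ C ∈ Cycle G ] darts C ≡ proj₁ s ∷ walkDarts w) ⊎
               walkDarts w ≡ reverseDart (proj₁ s) ∷ []
  closeCycle {u} {v} w uniq s@(d , refl , _) with closingEdge w uniq s
  ... | inj₂ eq  = inj₂ eq
  ... | inj₁ new = inj₁ (C , refl)
    where
    C : Cycle G
    C = record
      { first            = s
      ; rest             = w
      ; distinctVertices = end≢sources w uniq ∷ simple⇒uniqueSources w uniq
      ; distinctEdges    = new ∷ simple⇒uniqueEdges w uniq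
      }

  record SplitAt {u v : Fin n} (x : Fin n) (w : Walk G u v) : Set where
    constructor splitAt
    field
      before      : Walk G u x
      after       : Walk G x v
      darts-split : walkDarts w ≡ walkDarts before ++ walkDarts after
      before⊆     : ∀ {y} → y ∈ visits before → y ∈ visits w
      before-uniq : Unique (visits w) → Unique (visits before)
      after-uniq  : Unique (visits w) → Unique (visits after)

  split : ∀ {u v x} (w : Walk G u v) → x ∈ visits w → SplitAt x w
  split ε        (here refl) = splitAt ε ε refl (λ y∈ → y∈) (λ q → q) (λ q → q)
  split (s ◅ w)  (here refl) = splitAt ε (s ◅ w) refl (λ { (here refl) → here refl }) (λ _ → [] ∷ []) (λ q → q)
  split (s ◅ w)  (there x∈)  with split w x∈
  ... | splitAt b a eq b⊆ bu au = splitAt (s ◅ b) a (cong (proj₁ s ∷_) eq)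
    (λ { (here refl) → here refl ; (there y∈) → there (b⊆ y∈) })
    (λ { (u≢ ∷ q) → All.tabulate (All.lookup u≢ ∘ b⊆) ∷ bu q })
    (λ { (_ ∷ q) → au q })

  open SplitAt

  -- If antisymmetric weights vanish on cycles, then cutting out closed parts makes a
  -- walk simple without changing its weight, so the weight depends on the ends only.
  module Balance (φ : Dart m → ℤ)
                 (φ-reverse : ∀ d → φ d ℤ.+ φ (reverseDart d) ≡ + 0) where

    weight : List (Dart m) → ℤ
    weight = List.foldr (λ d → ℤ._+_ (φ d)) (+ 0)

    weight-++ : ∀ ds ds′ → weight (ds ++ ds′) ≡ weight ds ℤ.+ weight ds′
    weight-++ []       ds′ = sym (ℤ.+-identityˡ _)
    weight-++ (d ∷ ds) ds′ = trans (cong (ℤ._+_ (φ d)) (weight-++ ds ds′)) (sym (ℤ.+-assoc (φ d) _ _))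

    weight-bounded : (∀ d → ℤ.∣ φ d ∣ ≤ 1) → ∀ ds → ℤ.∣ weight ds ∣ ≤ length ds
    weight-bounded φ≤1 []       = z≤n
    weight-bounded φ≤1 (d ∷ ds) =
      ℕ.≤-trans (ℤ.∣i+j∣≤∣i∣+∣j∣ (φ d) (weight ds)) (ℕ.+-mono-≤ (φ≤1 d) (weight-bounded φ≤1 ds))

    module _ (φ-cycle : ∀ (C : Cycle G) → weight (darts C) ≡ + 0) where

      -- The closed walk is a cycle, or it goes back and forth along one edge and then antisymmetry
      -- applies.
      weight-closed : ∀ {u v} (w : Walk G u v) → Unique (visits w) → (s : Step G v u) →
                      weight (proj₁ s ∷ walkDarts w) ≡ + 0
      weight-closed w uniq s with closeCycle w uniq s
      ... | inj₁ (C , eq) = trans (sym (cong weight eq)) (φ-cycle C)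
      ... | inj₂ eq = trans (cong (λ ds → weight (proj₁ s ∷ ds)) eq)
        (trans (cong (ℤ._+_ (φ (proj₁ s))) (ℤ.+-identityʳ _)) (φ-reverse (proj₁ s)))

      simplify : ∀ {u v} (w : Walk G u v) →
                 Σ[ p ∈ Walk G u v ] Unique (visits p) × weight (walkDarts w) ≡ weight (walkDarts p)
      simplify ε = ε , ([] ∷ []) , refl
      simplify {u} (s@(d , _) ◅ w) with simplify w
      ... | p , uniq , eq with DecMembership._∈?_ Fin._≟_ u (visits p)
      ...   | no  u∉ = s ◅ p , (All.¬Any⇒All¬ _ u∉ ∷ uniq) , cong (ℤ._+_ (φ d)) eq
      -- The walk returns to u: the part up to the return is a closed-up simple path of weight zero
      -- and is dropped.
      ...   | yes u∈ = after q , after-uniq q uniq , (begin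
        φ d ℤ.+ weight (walkDarts w)
          ≡⟨ cong (ℤ._+_ (φ d)) (trans eq (cong weight (darts-split q))) ⟩
        φ d ℤ.+ weight (walkDarts (before q) ++ walkDarts (after q))
          ≡⟨ weight-++ (d ∷ walkDarts (before q)) (walkDarts (after q)) ⟩
        weight (d ∷ walkDarts (before q)) ℤ.+ weight (walkDarts (after q))
          ≡⟨ cong (ℤ._+ weight (walkDarts (after q))) (weight-closed (before q) (before-uniq q uniq) s) ⟩
        + 0 ℤ.+ weight (walkDarts (after q))
          ≡⟨ ℤ.+-identityˡ _ ⟩
        weight (walkDarts (after q)) ∎)
        where
        open ≡-Reasoning
        q : SplitAt u p
        q = split p u∈

      weight-loop : ∀ {u} (w : Walk G u u) → weight (walkDarts w) ≡ + 0
      weight-loop w with simplify w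
      ... | ε     , _        , eq = eq
      ... | _ ◅ p , (u≢ ∷ _) , _  = contradiction refl (All.lookup u≢ (end∈visits p))

      -- Connectedness gives one return walk that closes up both walks to loops of weight zero; it
      -- then cancels.
      weight-unique : Connected G → ∀ {u v} (w w′ : Walk G u v) →
                      weight (walkDarts w) ≡ weight (walkDarts w′)
      weight-unique connected {u} {v} w w′ = ℤGroup.∙-cancelʳ (weight (walkDarts r)) _ _
        (trans (closed w) (sym (closed w′)))
        where
        r : Walk G v u
        r = connected v u

        walkDarts-◅◅ : ∀ {x y z} (a : Walk G x y) (b : Walk G y z) → walkDarts (a ◅◅ b) ≡ walkDarts a ++ walkDarts b
        walkDarts-◅◅ ε       b = refl
        walkDarts-◅◅ (s ◅ a) b = cong (proj₁ s ∷_) (walkDarts-◅◅ a b)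

        closed : (w : Walk G u v) → weight (walkDarts w) ℤ.+ weight (walkDarts r) ≡ + 0
        closed w = trans (sym (trans (cong weight (walkDarts-◅◅ w r)) (weight-++ (walkDarts w) _)))
          (weight-loop (w ◅◅ r))

  -- If the first vertex recurs on the tail, already known to be simple, then the part before the
  -- recurrence closes up to a directed cycle. Going back and forth along an edge is impossible, as
  -- only one of its two darts is forward.
  directed⇒simple : ∀ Y → Acyclic G Y → ∀ {u v} (w : Walk G u v) →
                    All (Forward Y) (walkDarts w) → Unique (visits w)
  directed⇒simple Y acyclic ε _ = [] ∷ []
  directed⇒simple Y acyclic {u} (s@(d , _) ◅ w) (d→ ∷ w→) with DecMembership._∈?_ Fin._≟_ u (visits w)
  ... | no  u∉ = All.¬Any⇒All¬ _ u∉ ∷ directed⇒simple Y acyclic w w→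
  ... | yes u∈ = ⊥-elim (directedCycle (closeCycle (before q) (before-uniq q uniq) s))
    where
    uniq : Unique (visits w)
    uniq = directed⇒simple Y acyclic w w→

    q : SplitAt u w
    q = split w u∈

    before→ : All (Forward Y) (walkDarts (before q))
    before→ = All.++⁻ˡ (walkDarts (before q)) (subst (All _) (darts-split q) w→)

    directedCycle : ¬ ((Σ[ C ∈ Cycle G ] darts C ≡ d ∷ walkDarts (before q)) ⊎
                       walkDarts (before q) ≡ reverseDart d ∷ [])
    directedCycle (inj₁ (C , eq)) = acyclic C (subst (All _) (sym eq) (d→ ∷ before→))
    directedCycle (inj₂ eq) with subst (All (Forward Y)) eq before→
    ... | rev→ ∷ [] = Bool.not-¬ d→ rev→

  directed⇒short : ∀ Y → Acyclic G Y → ∀ {u v} (w : Walk G u v) →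
                   All (Forward Y) (walkDarts w) → length (walkDarts w) < n
  directed⇒short Y acyclic w w→ =
    subst (_≤ n) (length-visits w) (unique⇒length≤ (directed⇒simple Y acyclic w w→))

-- Heights

countForward : ∀ {m} → Orientation m → List (Dart m) → ℕ
countForward X ds = length (filter (forward? X) ds)

-- On the way from X to Y, a vertex v is flipped h v ∸ h top times more often as a source than
-- as a sink (or h top ∸ h v times less often).
IsHeight : ∀ {n m} → Graph n m → Orientation m → Orientation m → (Fin n → ℕ) → Set
IsHeight G Y X h = ∀ e →
  h (proj₁ (lookup G e)) + bit (lookup Y e) ≡ h (proj₂ (lookup G e)) + bit (lookup X e)

module Imbalance {m : ℕ} (X Y : Orientation m) where

  indicator : Orientation m → Dart m → ℕ
  indicator Z (e , true)  = bit (lookup Z e)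
  indicator Z (e , false) = bit (not (lookup Z e))

  -- The height of the source minus the height of the target that `IsHeight` demands. Its sum along
  -- a cycle is the difference of the numbers of forward edges in X and in Y.
  φ : Dart m → ℤ
  φ d = indicator X d ℤ.⊖ indicator Y d

  φ-reverse : ∀ d → φ d ℤ.+ φ (reverseDart d) ≡ + 0
  φ-reverse (e , true)  with lookup X e | lookup Y e
  ... | true  | true  = refl
  ... | true  | false = refl
  ... | false | true  = refl
  ... | false | false = refl
  φ-reverse (e , false) with lookup X e | lookup Y e
  ... | true  | true  = refl
  ... | true  | false = refl
  ... | false | true  = refl
  ... | false | false = refl

  φ-bounded : ∀ d → ℤ.∣ φ d ∣ ≤ 1
  φ-bounded d = ℕ.≤-trans (ℤ.∣m⊝n∣≤m⊔n (indicator X d) (indicator Y d))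
    (ℕ.⊔-lub (indicator≤1 X d) (indicator≤1 Y d))
    where
    bit≤1 : ∀ b → bit b ≤ 1
    bit≤1 true  = s≤s z≤n
    bit≤1 false = z≤n

    indicator≤1 : ∀ Z d → indicator Z d ≤ 1
    indicator≤1 Z (e , true)  = bit≤1 (lookup Z e)
    indicator≤1 Z (e , false) = bit≤1 (not (lookup Z e))

  countForward-∷ : ∀ Z d ds → countForward Z (d ∷ ds) ≡ indicator Z d + countForward Z ds
  countForward-∷ Z (e , true)  ds with lookup Z e
  ... | true  = refl
  ... | false = refl
  countForward-∷ Z (e , false) ds with lookup Z e
  ... | true  = refl
  ... | false = refl

module _ {n m : ℕ} {G : Graph n m} (X Y : Orientation m) where

  open Imbalance X Y
  open Balance {G = G} φ φ-reverse

  weight-count : ∀ ds → weight ds ≡ countForward X ds ℤ.⊖ countForward Y ds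
  weight-count [] = refl
  weight-count (d ∷ ds) = begin
    (a ℤ.⊖ b) ℤ.+ weight ds
      ≡⟨ cong (ℤ._+_ (a ℤ.⊖ b)) (weight-count ds) ⟩
    (a ℤ.⊖ b) ℤ.+ (countForward X ds ℤ.⊖ countForward Y ds)
      ≡⟨ ⊖-+-⊖ a b (countForward X ds) (countForward Y ds) ⟩
    (a + countForward X ds) ℤ.⊖ (b + countForward Y ds)
      ≡⟨ cong₂ ℤ._⊖_ (sym (countForward-∷ X d ds)) (sym (countForward-∷ Y d ds)) ⟩
    countForward X (d ∷ ds) ℤ.⊖ countForward Y (d ∷ ds) ∎
    where
    open ≡-Reasoning
    a b : ℕ
    a = indicator X d
    b = indicator Y d

    rearrange : ∀ a b c d → (a ℤ.- b) ℤ.+ (c ℤ.- d) ≡ (a ℤ.+ c) ℤ.- (b ℤ.+ d)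
    rearrange = ℤSolver.solve-∀

    ⊖-+-⊖ : ∀ a b c d → (a ℤ.⊖ b) ℤ.+ (c ℤ.⊖ d) ≡ (a + c) ℤ.⊖ (b + d)
    ⊖-+-⊖ a b c d rewrite sym (ℤ.m-n≡m⊖n a b) | sym (ℤ.m-n≡m⊖n c d) | sym (ℤ.m-n≡m⊖n (a + c) (b + d)) =
      rearrange (+ a) (+ b) (+ c) (+ d)

  weight-↭ : ∀ {ds ds′} → ds ↭ ds′ → weight ds ≡ weight ds′
  weight-↭ {ds} {ds′} p = trans (weight-count ds) (trans
    (cong₂ ℤ._⊖_ (↭-length (filter-↭ (forward? X) p)) (↭-length (filter-↭ (forward? Y) p)))
    (sym (weight-count ds′)))

  weight-reverse : ∀ ds → weight ds ℤ.+ weight (map reverseDart ds) ≡ + 0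
  weight-reverse []       = refl
  weight-reverse (d ∷ ds) = trans (rearrange (φ d) (weight ds) (φ (reverseDart d)) (weight (map reverseDart ds)))
    (cong₂ ℤ._+_ (φ-reverse d) (weight-reverse ds))
    where
    rearrange : ∀ a b c d → (a ℤ.+ b) ℤ.+ (c ℤ.+ d) ≡ (a ℤ.+ c) ℤ.+ (b ℤ.+ d)
    rearrange = ℤSolver.solve-∀

  -- The hypotheses count forward edges in the fixed direction only; traversing the cycle the other
  -- way negates the weight, so it vanishes for both.
  weight-cycle : (δ : Directions G) (c : Cycle G → ℕ) →
                 IsCOrientation δ c X → IsCOrientation δ c Y →
                 ∀ C → weight (darts C) ≡ + 0
  weight-cycle δ c cX cY C = case same δ C of λ where
      (inj₁ p) → trans (sym (weight-↭ p)) directed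
      (inj₂ p) → trans (sym (trans (cong (ℤ._+_ (weight (darts C))) (trans (sym (weight-↭ p)) directed)) (ℤ.+-identityʳ _)))
                       (weight-reverse (darts C))
    where
    directed : weight (darts (direct δ C)) ≡ + 0
    directed = trans (weight-count (darts (direct δ C)))
      (trans (cong₂ ℤ._⊖_ (cX C) (cY C)) (ℤ.n⊖n≡0 (c C)))

  -- The height of u is the weight of a simple path from u to the root, plus n. Such a path has
  -- fewer than n darts, each of weight at most one in absolute value.
  height : Connected G → Fin n → (δ : Directions G) (c : Cycle G → ℕ) →
           IsCOrientation δ c X → IsCOrientation δ c Y →
           ∃[ h ] IsHeight G Y X h × (∀ u → h u ≤ n + n)
  height connected root δ c cX cY = h , isHeight , h≤
    where
    cycles : ∀ C → weight (darts C) ≡ + 0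
    cycles = weight-cycle δ c cX cY

    simplified : ∀ u → Σ[ p ∈ Walk G u root ] Unique (visits p) × _
    simplified u = simplify cycles (connected u root)

    path : ∀ u → Walk G u root
    path u = proj₁ (simplified u)

    x : Fin n → ℤ
    x u = weight (walkDarts (path u))

    h : Fin n → ℕ
    -- The absolute value merely converts to a natural number: by `x-bounded` the sum is not
    -- negative.
    h u = ℤ.∣ + n ℤ.+ x u ∣

    x-bounded : ∀ u → ℤ.∣ x u ∣ ≤ n
    x-bounded u = ℕ.≤-trans (weight-bounded φ-bounded (walkDarts (path u)))
      (ℕ.<⇒≤ (subst (_≤ n) (length-visits (path u)) (unique⇒length≤ (proj₁ (proj₂ (simplified u))))))

    h≤ : ∀ u → h u ≤ n + n
    h≤ u = ℕ.≤-trans (ℤ.∣i+j∣≤∣i∣+∣j∣ (+ n) (x u)) (ℕ.+-monoʳ-≤ n (x-bounded u))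

    shift-abs : ∀ k i → ℤ.∣ i ∣ ≤ k → + ℤ.∣ + k ℤ.+ i ∣ ≡ + k ℤ.+ i
    shift-abs k (+ i)    _   = refl
    shift-abs k -[1+ i ] i≤k rewrite ℤ.⊖-≥ i≤k = refl

    +h : ∀ u → + h u ≡ + n ℤ.+ x u
    +h u = shift-abs n (x u) (x-bounded u)

    rearrange : ∀ n a b x → (n ℤ.+ ((a ℤ.- b) ℤ.+ x)) ℤ.+ b ≡ (n ℤ.+ x) ℤ.+ a
    rearrange = ℤSolver.solve-∀

    isHeight : IsHeight G Y X h
    isHeight e = ℤ.+-injective (begin
      + h p ℤ.+ + b                          ≡⟨ cong (ℤ._+ + b) (+h p) ⟩
      (+ n ℤ.+ x p) ℤ.+ + b                  ≡⟨ cong (λ z → (+ n ℤ.+ z) ℤ.+ + b) step ⟩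
      (+ n ℤ.+ ((a ℤ.⊖ b) ℤ.+ x q)) ℤ.+ + b
        ≡⟨ cong (λ z → (+ n ℤ.+ (z ℤ.+ x q)) ℤ.+ + b) (sym (ℤ.m-n≡m⊖n a b)) ⟩
      (+ n ℤ.+ ((+ a ℤ.- + b) ℤ.+ x q)) ℤ.+ + b ≡⟨ rearrange (+ n) (+ a) (+ b) (x q) ⟩
      (+ n ℤ.+ x q) ℤ.+ + a                  ≡⟨ cong (ℤ._+ + a) (sym (+h q)) ⟩
      + h q ℤ.+ + a                          ∎)
      where
      open ≡-Reasoning
      p q : Fin n
      p = proj₁ (lookup G e)
      q = proj₂ (lookup G e)
      a b : ℕ
      a = bit (lookup X e)
      b = bit (lookup Y e)
      -- Two walks from p to the root are compared: the chosen path, and the edge followed by the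
      -- path chosen for q.
      step : x p ≡ (a ℤ.⊖ b) ℤ.+ x q
      step = weight-unique cycles connected (path p) (((e , true) , refl , refl) ◅ path q)

-- Ranks of an acyclic orientation

⨆ : ∀ {k} → (Fin k → ℕ) → ℕ
⨆ = foldr _⊔_ 0

≤⨆ : ∀ {k} (f : Fin k → ℕ) i → f i ≤ ⨆ f
≤⨆ f zero    = ℕ.m≤m⊔n _ _
≤⨆ f (suc i) = ℕ.≤-trans (≤⨆ (f ∘ suc) i) (ℕ.m≤n⊔m _ _)

⨆-attained : ∀ {k} (f : Fin k → ℕ) → ⨆ f ≡ 0 ⊎ ∃[ i ] ⨆ f ≡ f i
⨆-attained {zero}  f = inj₁ refl
⨆-attained {suc k} f with ℕ.⊔-sel (f zero) (⨆ (f ∘ suc)) | ⨆-attained (f ∘ suc)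
... | inj₁ eq | _             = inj₂ (zero , eq)
... | inj₂ eq | inj₁ eq′       = inj₁ (trans eq eq′)
... | inj₂ eq | inj₂ (i , eq′) = inj₂ (suc i , trans eq eq′)

module _ {n m : ℕ} {G : Graph n m} (Y : Orientation m) where

  -- The length of a longest directed walk from v among those with at most k steps.
  depth : ℕ → Fin n → ℕ
  via : ℕ → Fin n → Fin m → ℕ
  depth zero    v = 0
  depth (suc k) v = ⨆ (via k v)
  via k v e with tail G Y e Fin.≟ v
  ... | yes _ = suc (depth k (head G Y e))
  ... | no  _ = 0

  DirectedWalk : Fin n → ℕ → Set
  DirectedWalk v l = ∃[ u ] Σ[ w ∈ Walk G v u ] All (Forward Y) (walkDarts w) × length (walkDarts w) ≡ l

  depth-attained : ∀ k v → DirectedWalk v (depth k v)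
  depth-attained zero    v = v , ε , [] , refl
  depth-attained (suc k) v with ⨆-attained (via k v)
  ... | inj₁ eq = v , ε , [] , sym eq
  ... | inj₂ (e , eq) with tail G Y e Fin.≟ v
  ...   | no  _    = v , ε , [] , sym eq
  ...   | yes refl with depth-attained k (head G Y e)
  ...     | u , w , w→ , l = u , ((e , lookup Y e) , refl , refl) ◅ w , refl ∷ w→ , trans (cong suc l) (sym eq)

  depth-maximal : ∀ k {u v} (w : Walk G v u) → All (Forward Y) (walkDarts w) →
                  length (walkDarts w) ≤ k → length (walkDarts w) ≤ depth k v
  depth-maximal k       ε _ _ = z≤n
  depth-maximal (suc k) {v = v} (((e , b) , refl , refl) ◅ w) (refl ∷ w→) (s≤s l≤k) =
    ℕ.≤-trans via≥ (≤⨆ (via k v) e)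
    where
    via≥ : suc (length (walkDarts w)) ≤ via k v e
    via≥ with tail G Y e Fin.≟ tail G Y e
    ... | yes _ = s≤s (depth-maximal k w w→ l≤k)
    ... | no ne = contradiction refl ne

  -- The rank is the length of a longest directed walk. Directed walks have fewer than n darts, so
  -- the cap n of `depth` excludes none, and an edge can be put in front of a longest walk from its
  -- head.
  rank : Acyclic G Y → ∃[ a ] (∀ v → a v < n) × (∀ e → a (head G Y e) < a (tail G Y e))
  rank acyclic = depth n , short , decreasing
    where
    short : ∀ v → depth n v < n
    short v with depth-attained n v
    ... | u , w , w→ , l = subst (_< n) l (directed⇒short Y acyclic w w→)

    decreasing : ∀ e → depth n (head G Y e) < depth n (tail G Y e)
    decreasing e with depth-attained n (head G Y e)
    ... | u , w , w→ , l = subst (λ z → suc z ≤ depth n (tail G Y e)) l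
      (depth-maximal n w′ w′→ (ℕ.<⇒≤ (directed⇒short Y acyclic w′ w′→)))
      where
      w′ : Walk G (tail G Y e) u
      w′ = ((e , lookup Y e) , refl , refl) ◅ w

      w′→ : All (Forward Y) (walkDarts w′)
      w′→ = refl ∷ w→

-- The effect of a flip on the heights

∑ : ∀ {k} → (Fin k → ℕ) → ℕ
∑ = foldr _+_ 0

∑-mono : ∀ {k} {f g : Fin k → ℕ} → (∀ i → f i ≤ g i) → ∑ f ≤ ∑ g
∑-mono {zero}  _ = z≤n
∑-mono {suc k} le = ℕ.+-mono-≤ (le zero) (∑-mono (le ∘ suc))

∑-bounded : ∀ {k} {f : Fin k → ℕ} {c} → (∀ i → f i ≤ c) → ∑ f ≤ k * c
∑-bounded {zero}  _ = z≤n
∑-bounded {suc k} le = ℕ.+-mono-≤ (le zero) (∑-bounded (le ∘ suc))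

-- The summands a and b express a signed change at the single index j without subtraction.
∑-change : ∀ {k} {f g : Fin k → ℕ} {a b} j → (∀ i → i ≢ j → f i ≤ g i) →
           f j + a ≤ g j + b → ∑ f + a ≤ ∑ g + b
∑-change {suc k} {f} {g} {a} {b} zero le leⱼ = begin
  (f zero + ∑ (f ∘ suc)) + a ≡⟨ swap (f zero) _ a ⟩
  (f zero + a) + ∑ (f ∘ suc) ≤⟨ ℕ.+-mono-≤ leⱼ (∑-mono (λ i → le (suc i) (λ ()))) ⟩
  (g zero + b) + ∑ (g ∘ suc) ≡⟨ swap (g zero) b _ ⟩
  (g zero + ∑ (g ∘ suc)) + b ∎
  where
  open ℕ.≤-Reasoning
  swap : ∀ x y z → x + y + z ≡ x + z + y
  swap = ℕSolver.solve-∀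
∑-change {suc k} {f} {g} {a} {b} (suc j) le leⱼ = begin
  (f zero + ∑ (f ∘ suc)) + a ≡⟨ ℕ.+-assoc (f zero) _ a ⟩
  f zero + (∑ (f ∘ suc) + a)
    ≤⟨ ℕ.+-mono-≤ (le zero (λ ())) (∑-change j (λ i i≢j → le (suc i) (i≢j ∘ Fin.suc-injective)) leⱼ) ⟩
  g zero + (∑ (g ∘ suc) + b) ≡⟨ sym (ℕ.+-assoc (g zero) _ b) ⟩
  (g zero + ∑ (g ∘ suc)) + b ∎
  where open ℕ.≤-Reasoning

bit-injective : ∀ {b c} → bit b ≡ bit c → b ≡ c
bit-injective {true}  {true}  _ = refl
bit-injective {false} {false} _ = refl

distance : ∀ {n} → Fin n → (Fin n → ℕ) → ℕ
distance top h = ∑ (λ u → ∣ h u - h top ∣)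

-- Sinks of an orientation are sources of the reverse orientation; σ = false selects the latter.
orient : Bool → Bool → Bool
orient σ b = if σ then b else not b

-- Relative to the other vertices, a vertex that is flipped as a source loses one unit of height and
-- one that is flipped as a sink gains one.  The former is expressed by raising all the others.
shift : ∀ {n} → Bool → Fin n → (Fin n → ℕ) → Fin n → ℕ
shift σ v h u = h u + (if does (u Fin.≟ v) then bit (not σ) else bit σ)

module _ {n m : ℕ} (G : Graph n m) where

  IsExtremal : Bool → Orientation m → Fin n → Set
  IsExtremal σ X v = ∀ e → target G (e , orient σ (lookup X e)) ≢ v

  target-not : ∀ e b → target G (e , not b) ≡ source G (e , b)
  target-not e true  = refl
  target-not e false = refl

  extremal⇒sourceOrSink : ∀ σ X {v} → IsExtremal σ X v → IsSource G X v ⊎ IsSink G X v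
  extremal⇒sourceOrSink true  X ext = inj₁ ext
  extremal⇒sourceOrSink false X ext = inj₂ λ e tl≡v → ext e (trans (target-not e (lookup X e)) tl≡v)

  sourceOrSink⇒extremal : ∀ X {v} → IsSource G X v ⊎ IsSink G X v → ∃[ σ ] IsExtremal σ X v
  sourceOrSink⇒extremal X (inj₁ isSource) = true , isSource
  sourceOrSink⇒extremal X (inj₂ isSink)   = false , λ e tgt≡v → isSink e (trans (sym (target-not e (lookup X e))) tgt≡v)

  module _ {Y : Orientation m} where

    -- In the orientation selected by σ every edge at v leaves v, so v carries no loop. Reversing
    -- such an edge changes its bit by one, which the relative change of height at v compensates; on
    -- all other edges both ends are shifted alike.
    shift-isHeight : ∀ σ X v h → IsHeight G Y X h → IsExtremal σ X v →
                     IsHeight G Y (reverseAt G v X) (shift σ v h)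
    shift-isHeight σ X v h H ext e
      rewrite Vec.lookup∘tabulate (λ e → if does (incident? G e v) then not (lookup X e) else lookup X e) e =
      edge σ (lookup X e) (p Fin.≟ v) (q Fin.≟ v) (h p) (bit (lookup Y e)) (h q) (H e) (subst (_≢ v) (target-end _) (ext e))
      where
      p q : Fin n
      p = proj₁ (lookup G e)
      q = proj₂ (lookup G e)

      target-end : ∀ b → target G (e , b) ≡ (if b then q else p)
      target-end true  = refl
      target-end false = refl

      plus-zero : ∀ a b c d → a + b ≡ c + d → a + 0 + b ≡ c + 0 + d
      plus-zero a b c d rewrite ℕ.+-identityʳ a | ℕ.+-identityʳ c = λ eq → eq

      plus-one : ∀ a b c d → a + b ≡ c + d → a + 1 + b ≡ c + 1 + d
      plus-one a b c d rewrite ℕ.+-comm a 1 | ℕ.+-comm c 1 = cong suc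

      carryʳ : ∀ a b c → a + b ≡ c + 1 → a + 0 + b ≡ c + 1 + 0
      carryʳ a b c rewrite ℕ.+-identityʳ a | ℕ.+-identityʳ (c + 1) = λ eq → eq

      carryˡ : ∀ a b c → a + b ≡ c + 0 → a + 1 + b ≡ c + 0 + 1
      carryˡ a b c rewrite ℕ.+-comm a 1 | ℕ.+-comm (c + 0) 1 = cong suc

      edge : ∀ σ x (p≟v : Dec (p ≡ v)) (q≟v : Dec (q ≡ v)) a b c →
             a + b ≡ c + bit x → (if orient σ x then q else p) ≢ v →
             (a + (if does p≟v then bit (not σ) else bit σ)) + b ≡
             (c + (if does q≟v then bit (not σ) else bit σ)) +
               bit (if does p≟v ∨ does q≟v then not x else x)
      edge true  true  _         (yes q≡v) a b c eq ≢v = contradiction q≡v ≢v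
      edge true  false (yes p≡v) _         a b c eq ≢v = contradiction p≡v ≢v
      edge false true  (yes p≡v) _         a b c eq ≢v = contradiction p≡v ≢v
      edge false false _         (yes q≡v) a b c eq ≢v = contradiction q≡v ≢v
      edge true  true  (yes _)   (no _)    a b c eq ≢v = carryʳ a b c eq
      edge true  true  (no _)    (no _)    a b c eq ≢v = plus-one a b c (bit true) eq
      edge true  false (no _)    (yes _)   a b c eq ≢v = carryˡ a b c eq
      edge true  false (no _)    (no _)    a b c eq ≢v = plus-one a b c (bit false) eq
      edge false true  (no _)    (yes _)   a b c eq ≢v = carryʳ a b c eq
      edge false true  (no _)    (no _)    a b c eq ≢v = plus-zero a b c (bit true) eq
      edge false false (yes _)   (no _)    a b c eq ≢v = carryˡ a b c eq
      edge false false (no _)    (no _)    a b c eq ≢v = plus-zero a b c (bit false) eq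

    translate-isHeight : ∀ X h h′ c → IsHeight G Y X h → (∀ u → h u ≡ h′ u + c) → IsHeight G Y X h′
    translate-isHeight X h h′ c H eq e = ℕ.+-cancelʳ-≡ c _ _ (begin
      h′ _ + bit (lookup Y e) + c   ≡⟨ swap (h′ _) _ c ⟩
      h′ _ + c + bit (lookup Y e)   ≡⟨ cong (_+ bit (lookup Y e)) (sym (eq _)) ⟩
      h _ + bit (lookup Y e)        ≡⟨ H e ⟩
      h _ + bit (lookup X e)        ≡⟨ cong (_+ bit (lookup X e)) (eq _) ⟩
      h′ _ + c + bit (lookup X e)   ≡⟨ swap (h′ _) c _ ⟩
      h′ _ + bit (lookup X e) + c   ∎)
      where
      open ≡-Reasoning
      swap : ∀ x y z → x + y + z ≡ x + z + y
      swap = ℕSolver.solve-∀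

    flat⇒equal : ∀ X h {k} → IsHeight G Y X h → (∀ u → h u ≡ k) → X ≡ Y
    flat⇒equal X h {k} H flat = trans (sym (Vec.tabulate∘lookup X))
      (trans (Vec.tabulate-cong agree) (Vec.tabulate∘lookup Y))
      where
      agree : ∀ e → lookup X e ≡ lookup Y e
      agree e with H e
      ... | eq rewrite flat (proj₁ (lookup G e)) | flat (proj₂ (lookup G e)) =
        sym (bit-injective (ℕ.+-cancelˡ-≡ k _ _ eq))

    equal⇒flat : ∀ h → IsHeight G Y Y h → ∀ {u v} → Walk G u v → h u ≡ h v
    equal⇒flat h H ε = refl
    equal⇒flat h H (((e , true)  , refl , refl) ◅ w) = trans (ℕ.+-cancelʳ-≡ _ _ _ (H e)) (equal⇒flat h H w)
    equal⇒flat h H (((e , false) , refl , refl) ◅ w) = trans (sym (ℕ.+-cancelʳ-≡ _ _ _ (H e))) (equal⇒flat h H w)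

    -- As v differs from top, every other summand keeps its value and that of v drops by at most
    -- one. When the sequence ends, the orientation is Y, whose heights are constant by
    -- connectedness, and the distance is zero.
    distance≤length : Connected G → ∀ {top X vs} h → FlipSequence G top Y X vs → IsHeight G Y X h →
                      distance top h ≤ length vs
    distance≤length connected {top} h [] H = subst (distance top h ≤_) (ℕ.*-zeroʳ n)
      (∑-bounded λ u → ℕ.≤-reflexive (ℕ.m≡n⇒∣m-n∣≡0 (equal⇒flat h H (connected u top))))
    distance≤length connected {top} {X} h (_∷_ {v = v} {vs = vs} (v≢top , extremal) flips) H
      with sourceOrSink⇒extremal X extremal
    ... | σ , ext = begin
      distance top h      ≡⟨ sym (ℕ.+-identityʳ _) ⟩
      distance top h + 0  ≤⟨ ∑-change v others this ⟩
      distance top h′ + 1 ≤⟨ ℕ.+-monoˡ-≤ 1 (distance≤length connected h′ flips (shift-isHeight σ X v h H ext)) ⟩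
      length vs + 1       ≡⟨ ℕ.+-comm (length vs) 1 ⟩
      suc (length vs)     ∎
      where
      open ℕ.≤-Reasoning
      h′ : Fin n → ℕ
      h′ = shift σ v h

      shift-other : ∀ {u} → u ≢ v → h′ u ≡ h u + bit σ
      shift-other {u} u≢v with u Fin.≟ v
      ... | yes u≡v = contradiction u≡v u≢v
      ... | no  _   = refl

      shift-this : h′ v ≡ h v + bit (not σ)
      shift-this with v Fin.≟ v
      ... | yes _   = refl
      ... | no  v≢v = contradiction refl v≢v

      translate : ∀ a b c → ∣ a + c - b + c ∣ ≡ ∣ a - b ∣
      translate a b c rewrite ℕ.+-comm a c | ℕ.+-comm b c = ℕ.∣m+n-m+o∣≡∣n-o∣ c a b

      others : ∀ u → u ≢ v → ∣ h u - h top ∣ ≤ ∣ h′ u - h′ top ∣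
      others u u≢v rewrite shift-other u≢v | shift-other (v≢top ∘ sym) =
        ℕ.≤-reflexive (sym (translate (h u) (h top) (bit σ)))

      near : ∀ σ a b → ∣ a - b ∣ ≤ ∣ a + bit (not σ) - b + bit σ ∣ + 1
      near true a b rewrite ℕ.+-identityʳ a =
        subst (λ z → ∣ a - b ∣ ≤ ∣ a - b + 1 ∣ + z) (trans (ℕ.∣-∣-comm (b + 1) b) (ℕ.∣m-m+n∣≡n b 1))
          (ℕ.∣-∣-triangle a (b + 1) b)
      near false a b rewrite ℕ.+-identityʳ b | ℕ.+-comm ∣ a + 1 - b ∣ 1 =
        subst (λ z → ∣ a - b ∣ ≤ z + ∣ a + 1 - b ∣) (ℕ.∣m-m+n∣≡n a 1) (ℕ.∣-∣-triangle a (a + 1) b)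

      this : ∣ h v - h top ∣ + 0 ≤ ∣ h′ v - h′ top ∣ + 1
      this rewrite shift-this | shift-other (v≢top ∘ sym) | ℕ.+-identityʳ ∣ h v - h top ∣ = near σ (h v) (h top)

    height-step : ∀ X h → IsHeight G Y X h → ∀ e →
                  h (head G X e) ≡ h (tail G X e) × lookup X e ≡ lookup Y e ⊎ suc (h (head G X e)) ≡ h (tail G X e)
    height-step X h H e with lookup X e | lookup Y e | H e
    ... | true  | true  | eq = inj₁ (ℕ.+-cancelʳ-≡ _ _ _ (sym eq) , refl)
    ... | true  | false | eq = inj₂ (trans (ℕ.+-comm 1 _) (trans (sym eq) (ℕ.+-identityʳ _)))
    ... | false | true  | eq = inj₂ (trans (ℕ.+-comm 1 _) (trans eq (ℕ.+-identityʳ _)))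
    ... | false | false | eq = inj₁ (ℕ.+-cancelʳ-≡ _ _ _ eq , refl)

    module _ (a : Fin n → ℕ) (a<n : ∀ v → a v < n) (a-decreasing : ∀ e → a (head G Y e) < a (tail G Y e)) where

      -- X is acyclic because it descends in the lexicographic order of height and rank.
      descend : (Fin n → ℕ) → Fin n → ℕ
      descend h u = h u * n + a u

      -- Where X and Y agree, the heights are level and the rank decides. Elsewhere the height drops
      -- by one, and the factor n makes this outweigh any difference of ranks.
      descend-decreasing : ∀ X h → IsHeight G Y X h → ∀ e →
                           descend h (head G X e) < descend h (tail G X e)
      descend-decreasing X h H e with height-step X h H e
      ... | inj₁ (eq , X≡Y) rewrite eq | X≡Y = ℕ.+-monoʳ-< (h (source G (e , lookup Y e)) * n) (a-decreasing e)
      ... | inj₂ eq = begin-strict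
        h (head G X e) * n + a (head G X e) <⟨ ℕ.+-monoʳ-< _ (a<n _) ⟩
        h (head G X e) * n + n              ≡⟨ ℕ.+-comm _ n ⟩
        suc (h (head G X e)) * n            ≡⟨ cong (_* n) eq ⟩
        h (tail G X e) * n                  ≤⟨ ℕ.m≤m+n _ _ ⟩
        descend h (tail G X e)              ∎
        where open ℕ.≤-Reasoning

      descend-bound : ℕ
      descend-bound = (n + n) * n + n

      descend≤ : ∀ h → (∀ u → h u ≤ n + n) → ∀ u → descend h u ≤ descend-bound
      descend≤ h h≤ u = ℕ.+-mono-≤ (ℕ.*-monoˡ-≤ n (h≤ u)) (ℕ.<⇒≤ (a<n u))

      -- Walking backwards to a source increases `descend`, so its complement to the upper bound is
      -- taken as the decreasing measure; walking forwards to a sink decreases it directly.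
      progress : Bool → (Fin n → ℕ) → Fin n → ℕ
      progress true  h u = descend-bound ∸ descend h u
      progress false h u = descend h u

      progress≤ : ∀ σ h → (∀ u → h u ≤ n + n) → ∀ u → progress σ h u ≤ descend-bound
      progress≤ true  h h≤ u = ℕ.m∸n≤m descend-bound (descend h u)
      progress≤ false h h≤ u = descend≤ h h≤ u

      progress-decreasing : ∀ σ X h → IsHeight G Y X h → (∀ u → h u ≤ n + n) → ∀ e →
        progress σ h (source G (e , orient σ (lookup X e))) < progress σ h (target G (e , orient σ (lookup X e)))
      progress-decreasing true  X h H h≤ e = ℕ.∸-monoʳ-< (descend-decreasing X h H e) (descend≤ h h≤ _)
      progress-decreasing false X h H h≤ e
        rewrite target-not e (lookup X e) = descend-decreasing X h H e

    Beyond : Bool → Fin n → (Fin n → ℕ) → Fin n → Set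
    Beyond true  top h u = h top < h u
    Beyond false top h u = h u < h top

    -- Keeps the walk strictly on its side of top, so that it cannot end at top, where flips are
    -- forbidden.
    beyond-source : ∀ σ X top h → IsHeight G Y X h → ∀ e →
      Beyond σ top h (target G (e , orient σ (lookup X e))) → Beyond σ top h (source G (e , orient σ (lookup X e)))
    beyond-source true  X top h H e lt with height-step X h H e
    ... | inj₁ (eq , _) = subst (h top <_) eq lt
    ... | inj₂ eq       = ℕ.<-trans lt (ℕ.≤-reflexive eq)
    beyond-source false X top h H e lt rewrite target-not e (lookup X e) with height-step X h H e
    ... | inj₁ (eq , _) = subst (_< h top) (sym eq) lt
    ... | inj₂ eq       = ℕ.<-trans (ℕ.≤-reflexive eq) lt

-- Execution of programs

record Halts (p : Program) (s : Store) (bound : ℕ) (Post : Store → Set) : Set where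
  constructor halts
  field
    {final} : Store
    {time}  : ℕ
    run     : ⟨ p , s ⟩⇓⟨ final , time ⟩
    time≤   : time ≤ bound
    post    : Post final

weaken : ∀ {p s T U Post} → T ≤ U → Halts p s T Post → Halts p s U Post
weaken T≤U (halts run time≤ post) = halts run (ℕ.≤-trans time≤ T≤U) post

mapPost : ∀ {p s T P Q} → (∀ {s′} → P s′ → Q s′) → Halts p s T P → Halts p s T Q
mapPost f (halts run time≤ post) = halts run time≤ (f post)

assign-halts : ∀ {s a i x} {Post : Store → Set} → Post (write s a (eval s i) (eval s x)) →
               Halts (a [ i ]≔ x) s (suc (cost i + cost x)) Post
assign-halts post = halts assign ℕ.≤-refl post

seq-halts : ∀ {p q s T U Mid Post} → Halts p s T Mid → (∀ {s′} → Mid s′ → Halts q s′ U Post) →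
            Halts (p ⨾ q) s (T + U) Post
seq-halts (halts run time≤ mid) next with next mid
... | halts run′ time≤′ post = halts (seq run run′) (ℕ.+-mono-≤ time≤ time≤′) post

then-halts : ∀ {b p q s T Post} → eval s b ≢ 0 → Halts p s T Post →
             Halts (if b then p else′ q) s (suc (cost b + T)) Post
then-halts {b} nz (halts run time≤ post) = halts (if-true nz run) (s≤s (ℕ.+-monoʳ-≤ (cost b) time≤)) post

else-halts : ∀ {b p q s T Post} → eval s b ≡ 0 → Halts q s T Post →
             Halts (if b then p else′ q) s (suc (cost b + T)) Post
else-halts {b} z (halts run time≤ post) = halts (if-false z run) (s≤s (ℕ.+-monoʳ-≤ (cost b) time≤)) post

whileBound : Expr → ℕ → ℕ → ℕ
whileBound b T k = suc (cost b) + k * suc (cost b + T)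

-- The variant k may drop by any positive amount, so the recursion is on its upper bound K, and the
-- time is charged for K iterations.
while-halts : ∀ {b p T} (I : ℕ → Store → Set) →
              (∀ {k s} → I k s → eval s b ≢ 0 → Halts p s T (λ s′ → ∃[ k′ ] k′ < k × I k′ s′)) →
              ∀ K {k s} → k ≤ K → I k s →
              Halts (while b loop p) s (whileBound b T K) (λ s′ → eval s′ b ≡ 0 × ∃[ k′ ] I k′ s′)
while-halts {b} {p} {T} I step K {k} {s} k≤K inv with eval s b ℕ.≟ 0
... | yes z = halts (while-done z) (ℕ.m≤m+n _ _) (z , k , inv)
... | no nz with step inv nz
...   | halts run time≤ (k′ , k′<k , inv′) with K
...     | zero   = contradiction (ℕ.≤-trans k′<k k≤K) λ ()
...     | suc K′ with while-halts I step K′ (ℕ.≤-pred (ℕ.≤-trans k′<k k≤K)) inv′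
...       | halts run′ time≤′ post = halts (while-true nz run run′)
  (ℕ.≤-trans (s≤s (ℕ.+-mono-≤ (ℕ.+-monoʳ-≤ (cost b) time≤) time≤′))
             (ℕ.≤-reflexive (rearrange (cost b) T (K′ * suc (cost b + T))))) post
  where
  rearrange : ∀ c T x → suc (c + T + (suc c + x)) ≡ suc c + (suc (c + T) + x)
  rearrange = ℕSolver.solve-∀

write-here : ∀ s a i x {j} → i ≡ j → write s a i x a j ≡ x
write-here s a i x refl with a ℕ.≟ a | i ℕ.≟ i
... | yes _ | yes _ = refl
... | yes _ | no ne = contradiction refl ne
... | no ne | _     = contradiction refl ne

write-there : ∀ s a i x {j} → i ≢ j → write s a i x a j ≡ s a j
write-there s a i x {j} i≢j with a ℕ.≟ a | i ℕ.≟ j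
... | yes _ | yes eq = contradiction eq i≢j
... | yes _ | no _   = refl
... | no _  | _      = refl

-- Array 6 holds the heights; cells 0, 1 and 2 of array 7 hold an edge, the vertex
-- that is to be brought to its final height, and the vertex that is a candidate for a flip.

vertices edges top′ edge vertex candidate : Expr
vertices  = 0 [ lit 0 ]
edges     = 0 [ lit 1 ]
top′      = 0 [ lit 2 ]
edge      = 7 [ lit 0 ]
vertex    = 7 [ lit 1 ]
candidate = 7 [ lit 2 ]

-- The two sides of `IsHeight` at the current edge, the right one for the start orientation in array
-- 3.
lhs rhs : Expr
lhs = 6 [ 1 [ edge ] ] ⊕ 4 [ edge ]
rhs = 6 [ 2 [ edge ] ] ⊕ 3 [ edge ]

restart nextEdge : Program
restart  = 7 [ lit 0 ]≔ lit 0
nextEdge = 7 [ lit 0 ]≔ edge ⊕ lit 1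

-- Raising an end may violate edges that the scan has already passed, hence the restart.
raise : ℕ → Program
raise a = 6 [ a [ edge ] ]≔ 6 [ a [ edge ] ] ⊕ lit 1 ⨾ restart

relaxEdge relax : Program
relaxEdge =
  if lhs ⊖ rhs then raise 2 else′
  if rhs ⊖ lhs then raise 1 else′
  nextEdge
relax = while edges ⊖ edge loop relaxEdge

endArray : Bool → ℕ
endArray true  = 1
endArray false = 2

-- The sum of the two truncated differences is nonzero exactly if the target of the edge, directed
-- by b, is not the candidate.
follow : Bool → Program
follow b =
  if (endArray (not b) [ edge ] ⊖ candidate) ⊕ (candidate ⊖ endArray (not b) [ edge ])
  then nextEdge
  else′ (7 [ lit 2 ]≔ endArray b [ edge ] ⨾ restart)

-- When array 6 holds heights of an orientation, the condition is the direction of the edge in it.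
followEdge walk : Bool → Program
followEdge σ =
  if lhs ⊖ 6 [ 2 [ edge ] ] then follow (orient σ true) else′ follow (orient σ false)
walk σ = while edges ⊖ edge loop followEdge σ

moved : Bool → Expr
moved true  = 6 [ candidate ] ⊖ lit 1
moved false = 6 [ candidate ] ⊕ lit 1

moveBy : Bool → ℕ → ℕ
moveBy true  k = k ∸ 1
moveBy false k = k + 1

eval-moved : ∀ σ s → eval s (moved σ) ≡ moveBy σ (s 6 (s 7 2))
eval-moved true  s = refl
eval-moved false s = refl

flip : Bool → Program
flip σ =
  7 [ lit 2 ]≔ vertex ⨾
  restart ⨾
  walk σ ⨾
  6 [ candidate ]≔ moved σ ⨾
  5 [ lit 1 ⊕ 5 [ lit 0 ] ]≔ candidate ⨾
  5 [ lit 0 ]≔ lit 1 ⊕ 5 [ lit 0 ]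

-- The vertex that gets flipped is the end of the walk, in general not `vertex`; the latter only
-- starts the walk and stays in place until it is level with top.
flipOrAdvance flipAll shortestFlips : Program
flipOrAdvance =
  if 6 [ vertex ] ⊖ 6 [ top′ ] then flip true else′
  if 6 [ top′ ] ⊖ 6 [ vertex ] then flip false else′
  7 [ lit 1 ]≔ vertex ⊕ lit 1
flipAll = while vertices ⊖ vertex loop flipOrAdvance
shortestFlips = relax ⨾ flipAll

-- Heights of at most n + n allow n * (n + n) raises in total, and as many flips; a walk has at most
-- `descend-bound` steps. The factor suc m pays for a scan of the edges after each raise or step.
-- The number 50 generously covers the commands of constant cost.
relaxBound walkBound flipBound flipAllBound : ℕ → ℕ → ℕ
relaxBound n m = whileBound (edges ⊖ edge) 50 (n * (n + n) * suc m + m)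
walkBound n m = whileBound (edges ⊖ edge) 50 (((n + n) * n + n) * suc m + m)
flipBound n m = 50 + walkBound n m
flipAllBound n m = whileBound (vertices ⊖ vertex) (flipBound n m) (n * (n + n) + n)

-- Correctness of the algorithm

heights : ∀ {n} → (ℕ → ℕ) → Fin n → ℕ
heights a u = a (toℕ u)

-- Computing heights by relaxation

module _ {n m : ℕ} (G : Graph n m) (top : Fin n) (Y : Orientation m) where

  private
    p q : Fin m → Fin n
    p e = proj₁ (lookup G e)
    q e = proj₂ (lookup G e)

  -- Parametrised by the arrays instead of the store: writes to arrays 5, 6 and 7 compute away on
  -- these, so the invariant survives them definitionally.
  record LoadedArrays (a₀ a₁ a₂ a₄ : ℕ → ℕ) : Set where
    field
      vertexCount : a₀ 0 ≡ n
      edgeCount   : a₀ 1 ≡ m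
      topVertex   : a₀ 2 ≡ toℕ top
      firstEnd    : ∀ e → a₁ (toℕ e) ≡ toℕ (p e)
      secondEnd   : ∀ e → a₂ (toℕ e) ≡ toℕ (q e)
      goal        : ∀ e → a₄ (toℕ e) ≡ bit (lookup Y e)
  open LoadedArrays

  Loaded : Store → Set
  Loaded s = LoadedArrays (s 0) (s 1) (s 2) (s 4)

  currentEdge : ∀ s → Loaded s → eval s (edges ⊖ edge) ≢ 0 → ∃[ e ] s 7 0 ≡ toℕ {m} e
  currentEdge s L nz = fromℕ< lt , sym (Fin.toℕ-fromℕ< lt)
    where
    lt : s 7 0 < m
    lt = subst (s 7 0 <_) (edgeCount L) (ℕ.m∸n≢0⇒n<m nz)

  noEdgeLeft : ∀ s → Loaded s → eval s (edges ⊖ edge) ≡ 0 → ∀ (e : Fin m) → toℕ e < s 7 0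
  noEdgeLeft s L z e = ℕ.<-≤-trans (Fin.toℕ<n e) (subst (_≤ s 7 0) (edgeCount L) (ℕ.m∸n≡0⇒m≤n z))

  eval-lhs : ∀ s e → Loaded s → s 7 0 ≡ toℕ e → eval s lhs ≡ heights (s 6) (p e) + bit (lookup Y e)
  eval-lhs s e L eq rewrite eq | firstEnd L e | goal L e = refl

  extend-below : ∀ {Q : Fin m → Set} {k e} → k ≡ toℕ e → (∀ e → toℕ e < k → Q e) → Q e →
                 ∀ e → toℕ e < k + 1 → Q e
  extend-below {Q} {k} {e} eq below new e′ lt rewrite ℕ.+-comm k 1 with ℕ.m<1+n⇒m<n∨m≡n lt
  ... | inj₁ lt′ = below e′ lt′
  ... | inj₂ eq′ = subst Q (Fin.toℕ-injective (trans (sym eq) (sym eq′))) new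

  -- The measure encodes a lexicographic order: D bounds the raises or steps still to come, and the
  -- number of edges left in the scan, at most m, stays below the factor suc m.
  next-measure : ∀ D (e : Fin m) {k} → k ≡ toℕ e → D * suc m + (m ∸ (k + 1)) < D * suc m + (m ∸ k)
  next-measure D e {k} eq rewrite ℕ.+-comm k 1 = ℕ.+-monoʳ-< (D * suc m)
    (ℕ.∸-monoʳ-< ℕ.≤-refl (subst (_< m) (sym eq) (Fin.toℕ<n e)))

  restart-measure : ∀ {D D′} x → D′ < D → D′ * suc m + m < D * suc m + x
  restart-measure {D} {D′} x lt = begin-strict
    D′ * suc m + m ≡⟨ ℕ.+-comm _ m ⟩
    m + D′ * suc m <⟨ ℕ.n<1+n _ ⟩
    suc D′ * suc m ≤⟨ ℕ.*-monoˡ-≤ (suc m) lt ⟩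
    D * suc m      ≤⟨ ℕ.m≤m+n _ x ⟩
    D * suc m + x  ∎
    where open ℕ.≤-Reasoning

  module _ (X : Orientation m) (h* : Fin n → ℕ) (H* : IsHeight G Y X h*) where

    deficit : (ℕ → ℕ) → ℕ
    deficit a = ∑ (λ u → h* u ∸ heights a u)

    record Relaxing (k : ℕ) (s : Store) : Set where
      field
        loaded    : Loaded s
        start     : ∀ e → s 3 (toℕ e) ≡ bit (lookup X e)
        noOutput  : s 5 0 ≡ 0
        atZero    : s 7 1 ≡ 0
        below     : ∀ u → heights (s 6) u ≤ h* u
        satisfied : ∀ e → toℕ e < s 7 0 → heights (s 6) (p e) + bit (lookup Y e) ≡ heights (s 6) (q e) + bit (lookup X e)
        measure   : k ≡ deficit (s 6) * suc m + (m ∸ s 7 0)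
    open Relaxing

    eval-rhs : ∀ {k} s e → Relaxing k s → s 7 0 ≡ toℕ e → eval s rhs ≡ heights (s 6) (q e) + bit (lookup X e)
    eval-rhs s e I eq rewrite eq | secondEnd (loaded I) e | start I e = refl

    raise-relaxing : ∀ {k s i x} u → Relaxing k s → i ≡ toℕ u → x ≡ heights (s 6) u + 1 → heights (s 6) u < h* u →
                     ∃[ k′ ] k′ < k × Relaxing k′ (write (write s 6 i x) 7 0 0)
    raise-relaxing {k} {s} {i} {x} u I refl refl lt = _ , decreased , record
      { loaded    = loaded I
      ; start     = start I
      ; noOutput  = noOutput I
      ; atZero    = atZero I
      ; below     = below′
      ; satisfied = λ _ ()
      ; measure   = refl
      }
      where
      a′ : ℕ → ℕ
      a′ = write s 6 (toℕ u) x 6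

      here′ : heights a′ u ≡ suc (heights (s 6) u)
      here′ = trans (write-here s 6 (toℕ u) _ refl) (ℕ.+-comm _ 1)

      there′ : ∀ {v} → v ≢ u → heights a′ v ≡ heights (s 6) v
      there′ v≢u = write-there s 6 (toℕ u) _ (λ eq → v≢u (sym (Fin.toℕ-injective eq)))

      below′ : ∀ v → heights a′ v ≤ h* v
      below′ v with v Fin.≟ u
      ... | yes refl = subst (_≤ h* u) (sym here′) lt
      ... | no  v≢u  = subst (_≤ h* v) (sym (there′ v≢u)) (below I v)

      deficit-drops : deficit a′ + 1 ≤ deficit (s 6) + 0
      deficit-drops = ∑-change u (λ v v≢u → ℕ.≤-reflexive (cong (h* v ∸_) (there′ v≢u))) (begin
        (h* u ∸ heights a′ u) + 1          ≡⟨ cong (λ z → h* u ∸ z + 1) here′ ⟩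
        (h* u ∸ suc (heights (s 6) u)) + 1 ≡⟨ ℕ.+-comm _ 1 ⟩
        suc (h* u ∸ suc (heights (s 6) u)) ≡⟨ sym (ℕ.+-∸-assoc 1 lt) ⟩
        h* u ∸ heights (s 6) u             ≡⟨ sym (ℕ.+-identityʳ _) ⟩
        (h* u ∸ heights (s 6) u) + 0       ∎)
        where open ℕ.≤-Reasoning

      decreased : deficit a′ * suc m + m < k
      decreased = subst (deficit a′ * suc m + m <_) (sym (measure I)) (restart-measure (m ∸ s 7 0) (begin
        suc (deficit a′)  ≡⟨ ℕ.+-comm 1 _ ⟩
        deficit a′ + 1    ≤⟨ deficit-drops ⟩
        deficit (s 6) + 0 ≡⟨ ℕ.+-identityʳ _ ⟩
        deficit (s 6)     ∎))
        where open ℕ.≤-Reasoning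

    relaxEdge-halts : ∀ {k s} → Relaxing k s → eval s (edges ⊖ edge) ≢ 0 →
                      Halts relaxEdge s 50 (λ s′ → ∃[ k′ ] k′ < k × Relaxing k′ s′)
    relaxEdge-halts {k} {s} I nz = body (ℕ.<-cmp lhs-value rhs-value)
      where
      e : Fin m
      e = proj₁ (currentEdge s (loaded I) nz)
      at-e : s 7 0 ≡ toℕ e
      at-e = proj₂ (currentEdge s (loaded I) nz)

      lhs-value rhs-value : ℕ
      lhs-value = eval s lhs
      rhs-value = eval s rhs

      lhs≡ : lhs-value ≡ heights (s 6) (p e) + bit (lookup Y e)
      lhs≡ = eval-lhs s e (loaded I) at-e

      rhs≡ : rhs-value ≡ heights (s 6) (q e) + bit (lookup X e)
      rhs≡ = eval-rhs s e I at-e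

      index₁ : s 1 (s 7 0) ≡ toℕ (p e)
      index₁ = trans (cong (s 1) at-e) (firstEnd (loaded I) e)

      index₂ : s 2 (s 7 0) ≡ toℕ (q e)
      index₂ = trans (cong (s 2) at-e) (secondEnd (loaded I) e)

      -- The other end is still at most `h*`, so equality of the two sides for `h*` leaves room at
      -- the lagging end.
      room₂ : rhs-value < lhs-value → heights (s 6) (q e) < h* (q e)
      room₂ lt = ℕ.+-cancelʳ-< (bit (lookup X e)) _ _ (begin-strict
        heights (s 6) (q e) + bit (lookup X e) ≡⟨ sym rhs≡ ⟩
        rhs-value                              <⟨ lt ⟩
        lhs-value                              ≡⟨ lhs≡ ⟩
        heights (s 6) (p e) + bit (lookup Y e) ≤⟨ ℕ.+-monoˡ-≤ _ (below I (p e)) ⟩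
        h* (p e) + bit (lookup Y e)            ≡⟨ H* e ⟩
        h* (q e) + bit (lookup X e)            ∎)
        where open ℕ.≤-Reasoning

      room₁ : lhs-value < rhs-value → heights (s 6) (p e) < h* (p e)
      room₁ lt = ℕ.+-cancelʳ-< (bit (lookup Y e)) _ _ (begin-strict
        heights (s 6) (p e) + bit (lookup Y e) ≡⟨ sym lhs≡ ⟩
        lhs-value                              <⟨ lt ⟩
        rhs-value                              ≡⟨ rhs≡ ⟩
        heights (s 6) (q e) + bit (lookup X e) ≤⟨ ℕ.+-monoˡ-≤ _ (below I (q e)) ⟩
        h* (q e) + bit (lookup X e)            ≡⟨ sym (H* e) ⟩
        h* (p e) + bit (lookup Y e)            ∎)
        where open ℕ.≤-Reasoning

      advance : lhs-value ≡ rhs-value → ∃[ k′ ] k′ < k × Relaxing k′ (write s 7 0 (s 7 0 + 1))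
      advance eq = _ , subst (_ <_) (sym (measure I)) (next-measure (deficit (s 6)) e at-e) , record
        { loaded    = loaded I
        ; start     = start I
        ; noOutput  = noOutput I
        ; atZero    = atZero I
        ; below     = below I
        ; satisfied = extend-below {Q = λ e → heights (s 6) (p e) + bit (lookup Y e) ≡ heights (s 6) (q e) + bit (lookup X e)}
                        at-e (satisfied I) (trans (sym lhs≡) (trans eq rhs≡))
        ; measure   = refl
        }

      body : Tri (lhs-value < rhs-value) (lhs-value ≡ rhs-value) (rhs-value < lhs-value) →
             Halts relaxEdge s 50 (λ s′ → ∃[ k′ ] k′ < k × Relaxing k′ s′)
      body (tri≈ _ eq _) = weaken (ℕ.≤ᵇ⇒≤ _ _ tt) (else-halts (ℕ.m≤n⇒m∸n≡0 (ℕ.≤-reflexive eq))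
        (else-halts (ℕ.m≤n⇒m∸n≡0 (ℕ.≤-reflexive (sym eq))) (assign-halts (advance eq))))
      body (tri< lt _ _) = weaken (ℕ.≤ᵇ⇒≤ _ _ tt) (else-halts (ℕ.m≤n⇒m∸n≡0 (ℕ.<⇒≤ lt))
        (then-halts (ℕ.m>n⇒m∸n≢0 lt) (seq-halts {Mid = λ s′ → s′ ≡ write s 6 (s 1 (s 7 0)) (s 6 (s 1 (s 7 0)) + 1)}
          (assign-halts refl) (λ { refl → assign-halts
          (raise-relaxing (p e) I index₁ (cong (λ z → s 6 z + 1) index₁) (room₁ lt)) }))))
      body (tri> _ _ lt) = weaken (ℕ.≤ᵇ⇒≤ _ _ tt) (then-halts (ℕ.m>n⇒m∸n≢0 lt)
        (seq-halts {Mid = λ s′ → s′ ≡ write s 6 (s 2 (s 7 0)) (s 6 (s 2 (s 7 0)) + 1)}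
          (assign-halts refl) (λ { refl → assign-halts
          (raise-relaxing (q e) I index₂ (cong (λ z → s 6 z + 1) index₂) (room₂ lt)) })))

-- Walking to a source or sink and flipping it

module _ {n m : ℕ} (G : Graph n m) (top : Fin n) (Y X : Orientation m)
         (a : Fin n → ℕ) (a<n : ∀ v → a v < n) (a-decreasing : ∀ e → a (head G Y e) < a (tail G Y e)) where

  open LoadedArrays

  endLoaded : ∀ s e b → Loaded G top Y s → s 7 0 ≡ toℕ e → s (endArray b) (s 7 0) ≡ toℕ (source G (e , b))
  endLoaded s e true  L eq = trans (cong (s 1) eq) (firstEnd L e)
  endLoaded s e false L eq = trans (cong (s 2) eq) (secondEnd L e)

  module _ (σ : Bool) (g₅ g₆ : ℕ → ℕ) (c : ℕ) (H : IsHeight G Y X (heights g₆))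
           (bounded : ∀ (u : Fin n) → heights g₆ u ≤ n + n) where

    steps : Fin n → ℕ
    steps = progress G {Y} a a<n a-decreasing σ (heights g₆)

    -- The parameters `g₅`, `g₆` and `c` freeze the output, the heights and the vertex cell, which
    -- the walk leaves alone. Once the scan is complete, `missed` says that w is a source or sink,
    -- as σ demands.
    record Walking (k : ℕ) (s : Store) : Set where
      field
        loaded    : Loaded G top Y s
        output    : s 5 ≡ g₅
        unchanged : s 6 ≡ g₆
        atVertex  : s 7 1 ≡ c
        w         : Fin n
        atW       : s 7 2 ≡ toℕ w
        beyond    : Beyond G {Y} σ top (heights g₆) w
        missed    : ∀ e → toℕ e < s 7 0 → target G (e , orient σ (lookup X e)) ≢ w
        measure   : k ≡ steps w * suc m + (m ∸ s 7 0)
    open Walking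

    follow-halts : ∀ {k s} e b → b ≡ orient σ (lookup X e) → Walking k s → s 7 0 ≡ toℕ e →
                   Halts (follow b) s 30 (λ s′ → ∃[ k′ ] k′ < k × Walking k′ s′)
    follow-halts {k} {s} e b refl I at-e = choose (target G (e , b) Fin.≟ w I)
      where
      target-value : s (endArray (not b)) (s 7 0) ≡ toℕ (target G (e , b))
      target-value = endLoaded s e (not b) (loaded I) at-e

      choose : Dec (target G (e , b) ≡ w I) →
               Halts (follow b) s 30 (λ s′ → ∃[ k′ ] k′ < k × Walking k′ s′)
      choose (yes eq) = weaken (ℕ.≤ᵇ⇒≤ _ _ tt) (else-halts zero-cond
        (seq-halts {Mid = λ s′ → s′ ≡ write s 7 2 (s (endArray b) (s 7 0))} (assign-halts refl) λ { refl → assign-halts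
          ( _
          , subst (steps (source G (e , b)) * suc m + m <_) (sym (measure I)) (restart-measure G top Y (m ∸ s 7 0)
              (subst (λ z → steps (source G (e , b)) < steps z) eq
                (progress-decreasing G {Y} a a<n a-decreasing σ X (heights g₆) H bounded e)))
          , record
            { loaded    = loaded I
            ; output    = output I
            ; unchanged = unchanged I
            ; atVertex  = atVertex I
            ; w         = source G (e , b)
            ; atW       = endLoaded s e b (loaded I) at-e
            ; beyond    = beyond-source G {Y} σ X top (heights g₆) H e (subst (Beyond G {Y} σ top (heights g₆)) (sym eq) (beyond I))
            ; missed    = λ _ ()
            ; measure   = refl
            }) }))
        where
        same-value : s (endArray (not b)) (s 7 0) ≡ s 7 2
        same-value = trans target-value (trans (cong toℕ eq) (sym (atW I)))

        zero-cond : (s (endArray (not b)) (s 7 0) ∸ s 7 2) + (s 7 2 ∸ s (endArray (not b)) (s 7 0)) ≡ 0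
        zero-cond rewrite same-value | ℕ.n∸n≡0 (s 7 2) = refl
      choose (no ne) = weaken (ℕ.≤ᵇ⇒≤ _ _ tt) (then-halts nonzero-cond (assign-halts
        ( _
        , subst (_ <_) (sym (measure I)) (next-measure G top Y (steps (w I)) e at-e)
        , record
          { loaded    = loaded I
          ; output    = output I
          ; unchanged = unchanged I
          ; atVertex  = atVertex I
          ; w         = w I
          ; atW       = atW I
          ; beyond    = beyond I
          ; missed    = extend-below G top Y {Q = λ e → target G (e , orient σ (lookup X e)) ≢ w I} at-e (missed I) ne
          ; measure   = refl
          })))
        where
        nonzero-cond : (s (endArray (not b)) (s 7 0) ∸ s 7 2) + (s 7 2 ∸ s (endArray (not b)) (s 7 0)) ≢ 0
        nonzero-cond z = ne (Fin.toℕ-injective (trans (sym target-value) (trans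
          (ℕ.≤-antisym (ℕ.m∸n≡0⇒m≤n (ℕ.m+n≡0⇒m≡0 _ z)) (ℕ.m∸n≡0⇒m≤n (ℕ.m+n≡0⇒n≡0 (s (endArray (not b)) (s 7 0) ∸ s 7 2) z)))
          (atW I))))

    followEdge-halts : ∀ {k s} → Walking k s → eval s (edges ⊖ edge) ≢ 0 →
                       Halts (followEdge σ) s 50 (λ s′ → ∃[ k′ ] k′ < k × Walking k′ s′)
    followEdge-halts {k} {s} I nz = choose (lookup X e) refl
      where
      e : Fin m
      e = proj₁ (currentEdge G top Y s (loaded I) nz)
      at-e : s 7 0 ≡ toℕ e
      at-e = proj₂ (currentEdge G top Y s (loaded I) nz)

      direction : eval s (lhs ⊖ 6 [ 2 [ edge ] ]) ≡ bit (lookup X e)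
      direction = begin
        eval s lhs ∸ s 6 (s 2 (s 7 0))
          ≡⟨ cong₂ _∸_ (eval-lhs G top Y s e (loaded I) at-e)
                       (cong (s 6) (endLoaded s e false (loaded I) at-e)) ⟩
        heights (s 6) (proj₁ (lookup G e)) + bit (lookup Y e) ∸ heights (s 6) (proj₂ (lookup G e))
          ≡⟨ cong (λ g → heights g (proj₁ (lookup G e)) + bit (lookup Y e) ∸ heights g (proj₂ (lookup G e))) (unchanged I) ⟩
        heights g₆ (proj₁ (lookup G e)) + bit (lookup Y e) ∸ heights g₆ (proj₂ (lookup G e))
          ≡⟨ cong (_∸ heights g₆ (proj₂ (lookup G e))) (H e) ⟩
        heights g₆ (proj₂ (lookup G e)) + bit (lookup X e) ∸ heights g₆ (proj₂ (lookup G e))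
          ≡⟨ ℕ.m+n∸m≡n (heights g₆ (proj₂ (lookup G e))) _ ⟩
        bit (lookup X e) ∎
        where open ≡-Reasoning

      choose : ∀ x → lookup X e ≡ x → Halts (followEdge σ) s 50 (λ s′ → ∃[ k′ ] k′ < k × Walking k′ s′)
      choose true  eq = weaken (ℕ.≤ᵇ⇒≤ _ _ tt) (then-halts (λ z → case trans (sym (trans direction (cong bit eq))) z of λ ())
        (follow-halts e (orient σ true) (cong (orient σ) (sym eq)) I at-e))
      choose false eq = weaken (ℕ.≤ᵇ⇒≤ _ _ tt) (else-halts (trans direction (cong bit eq))
        (follow-halts e (orient σ false) (cong (orient σ) (sym eq)) I at-e))

    walk-halts : ∀ {k s} → Walking k s →
                 Halts (walk σ) s (walkBound n m)
                   (λ s′ → Σ[ I ∈ ∃[ k′ ] Walking k′ s′ ] IsExtremal G σ X (w (proj₂ I)))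
    walk-halts {k} {s} I with while-halts Walking followEdge-halts (((n + n) * n + n) * suc m + m) k≤ I
      where
      k≤ : k ≤ ((n + n) * n + n) * suc m + m
      k≤ = subst (_≤ ((n + n) * n + n) * suc m + m) (sym (measure I))
        (ℕ.+-mono-≤ (ℕ.*-monoˡ-≤ (suc m) (progress≤ G {Y} a a<n a-decreasing σ (heights g₆) bounded (w I))) (ℕ.m∸n≤m m (s 7 0)))
    ... | halts {s′} run time≤ (done , k′ , I′) =
      halts run time≤ ((k′ , I′) , λ e → missed I′ e (noEdgeLeft G top Y s′ (loaded I′) done e))

  record Flipped (σ : Bool) (s s′ : Store) : Set where
    field
      flipLoaded  : Loaded G top Y s′
      sameVertex  : s′ 7 1 ≡ s 7 1
      w           : Fin n
      extremal    : IsExtremal G σ X w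
      wBeyond     : Beyond G {Y} σ top (heights (s 6)) w
      heightThis  : heights (s′ 6) w ≡ moveBy σ (heights (s 6) w)
      heightOther : ∀ {u} → u ≢ w → heights (s′ 6) u ≡ heights (s 6) u
      counted     : s′ 5 0 ≡ suc (s 5 0)
      newOutput   : s′ 5 (suc (s 5 0)) ≡ toℕ w
      oldOutput   : ∀ i → i < s 5 0 → s′ 5 (suc i) ≡ s 5 (suc i)

  flip-halts : ∀ σ s v → Loaded G top Y s → s 7 1 ≡ toℕ v → IsHeight G Y X (heights (s 6)) →
               (∀ u → heights (s 6) u ≤ n + n) → Beyond G {Y} σ top (heights (s 6)) v →
               Halts (flip σ) s (28 + walkBound n m) (Flipped σ s)
  flip-halts σ s v L at-v H bounded v-beyond = weaken (ℕ.≤-reflexive (bound-eq σ (walkBound n m)))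
    (seq-halts {Mid = λ s′ → s′ ≡ s₁} (assign-halts refl) λ { refl →
     seq-halts {Mid = λ s′ → s′ ≡ s₂} (assign-halts refl) λ { refl →
     seq-halts (walk-halts σ (s 5) (s 6) (s 7 1) H bounded initial) λ { {s₃} ((k , I) , ext) →
     seq-halts {Mid = λ s′ → s′ ≡ write s₃ 6 (s₃ 7 2) (eval s₃ (moved σ))} (assign-halts refl) λ { refl →
     seq-halts {Mid = λ s′ → s′ ≡ write (write s₃ 6 (s₃ 7 2) (eval s₃ (moved σ))) 5 (suc (s₃ 5 0)) (s₃ 7 2)}
       (assign-halts refl) λ { refl →
     assign-halts (flipped s₃ I ext) } } } } })
    where
    bound-eq : ∀ σ x → 4 + (3 + (x + (suc (2 + cost (moved σ)) + (7 + 6)))) ≡ 28 + x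
    bound-eq true  x = cong (λ z → 7 + z) (ℕ.+-comm x 21)
    bound-eq false x = cong (λ z → 7 + z) (ℕ.+-comm x 21)

    s₁ s₂ : Store
    s₁ = write s 7 2 (s 7 1)
    s₂ = write s₁ 7 0 0

    initial : Walking σ (s 5) (s 6) (s 7 1) H bounded _ s₂
    initial = record
      { loaded    = L
      ; output    = refl
      ; unchanged = refl
      ; atVertex  = refl
      ; w         = v
      ; atW       = at-v
      ; beyond    = v-beyond
      ; missed    = λ _ ()
      ; measure   = refl
      }

    module _ (s₃ : Store) {k : ℕ} (I : Walking σ (s 5) (s 6) (s 7 1) H bounded k s₃)
             (ext : IsExtremal G σ X (Walking.w I)) where

      flipped : Flipped σ s (write (write (write s₃ 6 (s₃ 7 2) (eval s₃ (moved σ))) 5 (suc (s₃ 5 0)) (s₃ 7 2)) 5 0 (suc (s₃ 5 0)))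
      flipped = record
        { flipLoaded  = Walking.loaded I
        ; sameVertex  = Walking.atVertex I
        ; w           = Walking.w I
        ; extremal    = ext
        ; wBeyond     = Walking.beyond I
        ; heightThis  = trans (write-here s₃ 6 (s₃ 7 2) _ (Walking.atW I)) (trans (eval-moved σ s₃)
            (cong (moveBy σ) (trans (cong (s₃ 6) (Walking.atW I)) (cong (λ g → g (toℕ (Walking.w I))) (Walking.unchanged I)))))
        ; heightOther = λ {u} u≢w → trans (write-there s₃ 6 (s₃ 7 2) _ {toℕ u}
            (λ eq → u≢w (sym (Fin.toℕ-injective (trans (sym (Walking.atW I)) eq))))) (cong (λ g → g (toℕ u)) (Walking.unchanged I))
        ; counted     = cong suc count
        ; newOutput   = trans (write-here s₄ 5 (suc (s₃ 5 0)) (s₃ 7 2) (cong suc count)) (Walking.atW I)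
        ; oldOutput   = λ i i< → trans (write-there s₄ 5 (suc (s₃ 5 0)) (s₃ 7 2)
            (λ eq → ℕ.<⇒≢ i< (sym (trans (sym count) (ℕ.suc-injective eq))))) (cong (λ g → g (suc i)) (Walking.output I))
        }
        where
        s₄ : Store
        s₄ = write s₃ 6 (s₃ 7 2) (eval s₃ (moved σ))

        count : s₃ 5 0 ≡ s 5 0
        count = cong (λ g → g 0) (Walking.output I)

-- The flip loop and its optimality

Written : ∀ {n} → (ℕ → ℕ) → List (Fin n) → Set
Written f []       = ⊤
Written f (v ∷ vs) = f 0 ≡ toℕ v × Written (f ∘ suc) vs

written-∷ʳ : ∀ {n} {f g : ℕ → ℕ} (vs : List (Fin n)) {v} → Written f vs →
             (∀ i → i < length vs → g i ≡ f i) → g (length vs) ≡ toℕ v → Written g (vs ∷ʳ v)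
written-∷ʳ []       _        _     new = new , tt
written-∷ʳ (_ ∷ vs) (p , ps) agree new =
  trans (agree 0 (s≤s z≤n)) p , written-∷ʳ vs ps (λ i i< → agree (suc i) (s≤s i<)) new

written-lookup : ∀ {n} {f : ℕ → ℕ} (vs : List (Fin n)) → Written f vs →
                 ∀ i → f (toℕ i) ≡ toℕ (List.lookup vs i)
written-lookup (_ ∷ _)  (p , _)  zero    = p
written-lookup (_ ∷ vs) (_ , ps) (suc i) = written-lookup vs ps i

-- Flips are found in chronological order, whereas the constructor of `FlipSequence` adds at the
-- front.
flips-∷ʳ : ∀ {n m} {G : Graph n m} {top X Z vs v} → FlipSequence G top Z X vs → Flippable G top Z v →
           FlipSequence G top (reverseAt G v Z) X (vs ∷ʳ v)
flips-∷ʳ []           last = last ∷ []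
flips-∷ʳ (first ∷ fs) last = first ∷ flips-∷ʳ fs last

module _ {n m : ℕ} (G : Graph n m) (top : Fin n) (Y : Orientation m)
         (a : Fin n → ℕ) (a<n : ∀ v → a v < n) (a-decreasing : ∀ e → a (head G Y e) < a (tail G Y e)) where

  open LoadedArrays

  beyond-irrefl : ∀ σ {h : Fin n → ℕ} {u} → Beyond G {Y} σ top h u → h u ≢ h top
  beyond-irrefl true  lt eq = ℕ.<⇒≢ lt (sym eq)
  beyond-irrefl false lt eq = ℕ.<⇒≢ lt eq

  module _ {X : Orientation m} {σ : Bool} {s s′ : Store} (H : IsHeight G Y X (heights (s 6)))
           (F : Flipped G top Y X a a<n a-decreasing σ s s′) where

    open Flipped F

    private
      h h′ : Fin n → ℕ
      h  = heights (s 6)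
      h′ = heights (s′ 6)

    w≢top : w ≢ top
    w≢top eq = beyond-irrefl σ wBeyond (cong h eq)

    sameTop : h′ top ≡ h top
    sameTop = heightOther (w≢top ∘ sym)

    -- For a source, `shift` raises all other vertices while the program lowers w alone; the results
    -- differ by a constant, which `translate-isHeight` absorbs.
    shifted : ∀ u → shift σ w h u ≡ h′ u + bit σ
    shifted u with u Fin.≟ w
    ... | no u≢w = cong (_+ bit σ) (sym (heightOther u≢w))
    ... | yes refl = trans (this σ wBeyond) (cong (_+ bit σ) (sym heightThis))
      where
      this : ∀ σ → Beyond G {Y} σ top h u → h u + bit (not σ) ≡ moveBy σ (h u) + bit σ
      -- The truncated subtraction is exact because a height above that of top is positive.
      this true  lt = trans (ℕ.+-identityʳ (h u)) (sym (ℕ.m∸n+n≡m (ℕ.≤-trans (s≤s z≤n) lt)))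
      this false lt = sym (ℕ.+-identityʳ _)

    flipped-isHeight : IsHeight G Y (reverseAt G w X) h′
    flipped-isHeight = translate-isHeight G {Y} (reverseAt G w X) (shift σ w h) h′ (bit σ)
      (shift-isHeight G {Y} σ X w h H extremal) shifted

    flipped-flippable : Flippable G top X w
    flipped-flippable = w≢top , extremal⇒sourceOrSink G σ X extremal

    flipped-bounded : ∀ {c} → (∀ u → h u ≤ c) → ∀ u → h′ u ≤ c
    flipped-bounded {c} h≤ u with u Fin.≟ w
    ... | no  u≢w  = subst (_≤ c) (sym (heightOther u≢w)) (h≤ u)
    ... | yes refl = subst (_≤ c) (sym heightThis) (this σ wBeyond)
      where
      this : ∀ σ → Beyond G {Y} σ top h u → moveBy σ (h u) ≤ c
      this true  _  = ℕ.≤-trans (ℕ.m∸n≤m (h u) 1) (h≤ u)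
      -- A raised vertex was below top, so afterwards it is at most as high as top.
      this false lt = ℕ.≤-trans (ℕ.≤-reflexive (ℕ.+-comm (h u) 1)) (ℕ.≤-trans lt (h≤ top))

    flipped-closer : distance top h′ + 1 ≤ distance top h
    flipped-closer = subst (distance top h′ + 1 ≤_) (ℕ.+-identityʳ _) (∑-change w
      (λ u u≢w → ℕ.≤-reflexive (cong₂ ∣_-_∣ (heightOther u≢w) sameTop)) this)
      where
      nearer : ∀ σ → Beyond G {Y} σ top h w → ∣ moveBy σ (h w) - h top ∣ + 1 ≡ ∣ h w - h top ∣
      nearer true lt with h w | lt
      ... | suc k | s≤s t≤k = begin
        ∣ k - h top ∣ + 1   ≡⟨ cong (_+ 1) (ℕ.m≤n⇒∣n-m∣≡n∸m t≤k) ⟩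
        k ∸ h top + 1       ≡⟨ ℕ.+-comm _ 1 ⟩
        suc (k ∸ h top)     ≡⟨ sym (ℕ.+-∸-assoc 1 t≤k) ⟩
        suc k ∸ h top       ≡⟨ sym (ℕ.m≤n⇒∣n-m∣≡n∸m (ℕ.m≤n⇒m≤1+n t≤k)) ⟩
        ∣ suc k - h top ∣   ∎
        where open ≡-Reasoning
      nearer false lt with h top | lt
      ... | suc k | s≤s w≤k = begin
        ∣ h w + 1 - suc k ∣ + 1 ≡⟨ cong (λ z → ∣ z - suc k ∣ + 1) (ℕ.+-comm (h w) 1) ⟩
        ∣ h w - k ∣ + 1         ≡⟨ cong (_+ 1) (ℕ.m≤n⇒∣m-n∣≡n∸m w≤k) ⟩
        k ∸ h w + 1             ≡⟨ ℕ.+-comm _ 1 ⟩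
        suc (k ∸ h w)           ≡⟨ sym (ℕ.+-∸-assoc 1 w≤k) ⟩
        suc k ∸ h w             ≡⟨ sym (ℕ.m≤n⇒∣m-n∣≡n∸m (ℕ.m≤n⇒m≤1+n w≤k)) ⟩
        ∣ h w - suc k ∣         ∎
        where open ≡-Reasoning

      this : ∣ h′ w - h′ top ∣ + 1 ≤ ∣ h w - h top ∣ + 0
      this = ℕ.≤-reflexive (begin
        ∣ h′ w - h′ top ∣ + 1 ≡⟨ cong (_+ 1) (cong₂ ∣_-_∣ heightThis sameTop) ⟩
        _                     ≡⟨ nearer σ wBeyond ⟩
        ∣ h w - h top ∣       ≡⟨ sym (ℕ.+-identityʳ _) ⟩
        ∣ h w - h top ∣ + 0   ∎)
        where open ≡-Reasoning

  module _ (X : Orientation m) (D : ℕ) where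

    -- D will be the distance at the start. By `budget` each flip spends a unit of it, so the final
    -- sequence has length at most D, the lower bound for all sequences.
    record Flipping (k : ℕ) (s : Store) : Set where
      field
        loaded   : Loaded G top Y s
        current  : Orientation m
        flipped  : List (Fin n)
        flips    : FlipSequence G top current X flipped
        isHeight : IsHeight G Y current (heights (s 6))
        bounded  : ∀ (u : Fin n) → heights (s 6) u ≤ n + n
        done     : ∀ (u : Fin n) → toℕ u < s 7 1 → heights (s 6) u ≡ heights (s 6) top
        count    : s 5 0 ≡ length flipped
        written  : Written (s 5 ∘ suc) flipped
        budget   : length flipped + distance top (heights (s 6)) ≤ D
        measure  : k ≡ distance top (heights (s 6)) + (n ∸ s 7 1)
    open Flipping

    flipOrAdvance-halts : ∀ {k s} → Flipping k s → eval s (vertices ⊖ vertex) ≢ 0 →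
                          Halts flipOrAdvance s (flipBound n m) (λ s′ → ∃[ k′ ] k′ < k × Flipping k′ s′)
    flipOrAdvance-halts {k} {s} I nz = choose (ℕ.<-cmp (h v) (h top))
      where
      h : Fin n → ℕ
      h = heights (s 6)

      s71<n : s 7 1 < n
      s71<n = subst (s 7 1 <_) (vertexCount (loaded I)) (ℕ.m∸n≢0⇒n<m nz)

      v : Fin n
      v = fromℕ< s71<n

      at-v : s 7 1 ≡ toℕ v
      at-v = sym (Fin.toℕ-fromℕ< s71<n)

      vertexHeight : s 6 (s 7 1) ≡ h v
      vertexHeight = cong (s 6) at-v

      topHeight : s 6 (s 0 2) ≡ h top
      topHeight = cong (s 6) (topVertex (loaded I))

      afterFlip : ∀ {σ s′} → Flipped G top Y (current I) a a<n a-decreasing σ s s′ → ∃[ k′ ] k′ < k × Flipping k′ s′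
      afterFlip {σ} {s′} F = _ , decreased , record
        { loaded   = flipLoaded
        ; current  = reverseAt G w (current I)
        ; flipped  = flipped I ∷ʳ w
        ; flips    = flips-∷ʳ (flips I) (flipped-flippable H F)
        ; isHeight = flipped-isHeight H F
        ; bounded  = flipped-bounded H F (bounded I)
        ; done     = done′
        ; count    = trans counted (trans (cong suc (count I)) (sym snoc-length))
        ; written  = written-∷ʳ (flipped I) (written I)
            (λ i i< → oldOutput i (subst (i <_) (sym (count I)) i<))
            (trans (cong (s′ 5 ∘ suc) (sym (count I))) newOutput)
        ; budget   = budget′
        ; measure  = refl
        }
        where
        open Flipped F

        H : IsHeight G Y (current I) h
        H = isHeight I

        snoc-length : length (flipped I ∷ʳ w) ≡ suc (length (flipped I))
        snoc-length = trans (List.length-++ (flipped I)) (ℕ.+-comm _ 1)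

        closer : distance top (heights (s′ 6)) < distance top h
        closer = subst (_≤ distance top h) (ℕ.+-comm _ 1) (flipped-closer H F)

        budget′ : length (flipped I ∷ʳ w) + distance top (heights (s′ 6)) ≤ D
        budget′ = begin
          length (flipped I ∷ʳ w) + distance top (heights (s′ 6))   ≡⟨ cong (_+ distance top (heights (s′ 6))) snoc-length ⟩
          suc (length (flipped I)) + distance top (heights (s′ 6))  ≡⟨ sym (ℕ.+-suc (length (flipped I)) _) ⟩
          length (flipped I) + suc (distance top (heights (s′ 6)))  ≤⟨ ℕ.+-monoʳ-≤ (length (flipped I)) closer ⟩
          length (flipped I) + distance top h                       ≤⟨ budget I ⟩
          D                                                         ∎
          where open ℕ.≤-Reasoning

        decreased : distance top (heights (s′ 6)) + (n ∸ s′ 7 1) < k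
        decreased rewrite sameVertex = subst (distance top (heights (s′ 6)) + (n ∸ s 7 1) <_) (sym (measure I))
          (ℕ.+-monoˡ-< (n ∸ s 7 1) closer)

        -- Vertices already passed are level with top and stay so, since only a vertex strictly
        -- above or below top is flipped.
        done′ : ∀ u → toℕ u < s′ 7 1 → heights (s′ 6) u ≡ heights (s′ 6) top
        done′ u u< = trans (heightOther u≢w) (trans flat (sym (sameTop H F)))
          where
          flat : h u ≡ h top
          flat = done I u (subst (toℕ u <_) sameVertex u<)

          u≢w : u ≢ w
          u≢w eq = beyond-irrefl σ wBeyond (subst (λ z → h z ≡ h top) eq flat)

      advance : h v ≡ h top → ∃[ k′ ] k′ < k × Flipping k′ (write s 7 1 (s 7 1 + 1))
      advance flat = _ , decreased , record
        { loaded   = loaded I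
        ; current  = current I
        ; flipped  = flipped I
        ; flips    = flips I
        ; isHeight = isHeight I
        ; bounded  = bounded I
        ; done     = done′
        ; count    = count I
        ; written  = written I
        ; budget   = budget I
        ; measure  = refl
        }
        where
        decreased : distance top h + (n ∸ (s 7 1 + 1)) < k
        decreased rewrite ℕ.+-comm (s 7 1) 1 = subst (distance top h + (n ∸ suc (s 7 1)) <_) (sym (measure I))
          (ℕ.+-monoʳ-< (distance top h) (ℕ.∸-monoʳ-< ℕ.≤-refl s71<n))

        done′ : ∀ u → toℕ u < s 7 1 + 1 → h u ≡ h top
        done′ u u< with ℕ.m<1+n⇒m<n∨m≡n (subst (toℕ u <_) (ℕ.+-comm (s 7 1) 1) u<)
        ... | inj₁ lt = done I u lt
        ... | inj₂ eq = trans (cong h (Fin.toℕ-injective (trans eq at-v))) flat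

      choose : Tri (h v < h top) (h v ≡ h top) (h top < h v) →
               Halts flipOrAdvance s (flipBound n m) (λ s′ → ∃[ k′ ] k′ < k × Flipping k′ s′)
      -- The flip costs 28 besides the walk, and each comparison with top adds 8, whence 36 and 44.
      choose (tri> _ _ gt) = weaken (ℕ.+-monoˡ-≤ (walkBound n m) (ℕ.≤ᵇ⇒≤ 36 50 tt)) (then-halts
        (λ z → ℕ.m>n⇒m∸n≢0 gt (trans (sym (cong₂ _∸_ vertexHeight topHeight)) z))
        (mapPost afterFlip (flip-halts G top Y (current I) a a<n a-decreasing true s v (loaded I) at-v (isHeight I) (bounded I) gt)))
      choose (tri< lt _ _) = weaken (ℕ.+-monoˡ-≤ (walkBound n m) (ℕ.≤ᵇ⇒≤ 44 50 tt)) (else-halts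
        (trans (cong₂ _∸_ vertexHeight topHeight) (ℕ.m≤n⇒m∸n≡0 (ℕ.<⇒≤ lt)))
        (then-halts (λ z → ℕ.m>n⇒m∸n≢0 lt (trans (sym (cong₂ _∸_ topHeight vertexHeight)) z))
          (mapPost afterFlip (flip-halts G top Y (current I) a a<n a-decreasing false s v (loaded I) at-v (isHeight I) (bounded I) lt))))
      choose (tri≈ _ eq _) = weaken (ℕ.≤-trans (ℕ.≤ᵇ⇒≤ _ 50 tt) (ℕ.m≤m+n 50 (walkBound n m))) (else-halts
        (trans (cong₂ _∸_ vertexHeight topHeight) (ℕ.m≤n⇒m∸n≡0 (ℕ.≤-reflexive eq)))
        (else-halts (trans (cong₂ _∸_ topHeight vertexHeight) (ℕ.m≤n⇒m∸n≡0 (ℕ.≤-reflexive (sym eq))))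
          (assign-halts (advance eq))))

    flipAll-halts : ∀ {k s} → Flipping k s → k ≤ n * (n + n) + n →
                    Halts flipAll s (flipAllBound n m)
                      (λ s′ → ∃[ vs ] FlipSequence G top Y X vs × length vs ≤ D × Outputs s′ vs)
    flipAll-halts I k≤ with while-halts Flipping flipOrAdvance-halts (n * (n + n) + n) k≤ I
    ... | halts {s′} run time≤ (end , k′ , I′) = halts run time≤
      ( flipped I′
      , subst (λ Z → FlipSequence G top Z X (flipped I′)) (flat⇒equal G (current I′) (heights (s′ 6)) (isHeight I′) flat) (flips I′)
      , ℕ.≤-trans (ℕ.m≤m+n _ _) (budget I′)
      , count I′
      , written-lookup (flipped I′) (written I′))
      where
      flat : ∀ u → heights (s′ 6) u ≡ heights (s′ 6) top
      flat u = done I′ u (ℕ.<-≤-trans (Fin.toℕ<n u) (subst (_≤ s′ 7 1) (vertexCount (loaded I′)) (ℕ.m∸n≡0⇒m≤n end)))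

  module _ (X : Orientation m) (h* : Fin n → ℕ) (H* : IsHeight G Y X h*) (h*≤ : ∀ u → h* u ≤ n + n) where

    open Relaxing

    relaxed⇒flipping : ∀ {k s} → Relaxing G top Y X h* H* k s → eval s (edges ⊖ edge) ≡ 0 →
                       Flipping X (distance top (heights (s 6))) (distance top (heights (s 6)) + (n ∸ s 7 1)) s
    relaxed⇒flipping {s = s} I end = record
      { loaded   = loaded I
      ; current  = X
      ; flipped  = []
      ; flips    = []
      ; isHeight = λ e → satisfied I e (noEdgeLeft G top Y s (loaded I) end e)
      ; bounded  = λ u → ℕ.≤-trans (below I u) (h*≤ u)
      ; done     = λ u u< → contradiction (subst (toℕ u <_) (atZero I) u<) λ ()
      ; count    = noOutput I
      ; written  = tt
      ; budget   = ℕ.≤-refl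
      ; measure  = refl
      }

    shortestFlips-halts : ∀ {s} → Connected G → Relaxing G top Y X h* H* (deficit G top Y X h* H* (s 6) * suc m + (m ∸ s 7 0)) s →
                          Halts shortestFlips s (relaxBound n m + flipAllBound n m)
                            (λ s′ → ∃[ vs ] IsShortestFlipSequence G top X Y vs × Outputs s′ vs)
    shortestFlips-halts {s} connected I = seq-halts
      (while-halts (Relaxing G top Y X h* H*) (relaxEdge-halts G top Y X h* H*) (n * (n + n) * suc m + m) k≤ I)
      λ { {s′} (end , k′ , I′) → mapPost
          (λ (vs , fs , short , out) → vs , (fs , λ ws gs → ℕ.≤-trans short
            (distance≤length G connected (heights (s′ 6)) gs (Flipping.isHeight (relaxed⇒flipping I′ end)))) , out)
          (flipAll-halts X _ (relaxed⇒flipping I′ end) (ℕ.+-mono-≤ (∑-bounded (λ u →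
            ℕ.≤-trans (ℕ.∣m-n∣≤m⊔n (heights (s′ 6) u) _) (ℕ.⊔-lub (h≤ I′ u) (h≤ I′ top)))) (ℕ.m∸n≤m n (s′ 7 1)))) }
      where
      h≤ : ∀ {k s} → Relaxing G top Y X h* H* k s → ∀ u → heights (s 6) u ≤ n + n
      h≤ I u = ℕ.≤-trans (below I u) (h*≤ u)

      k≤ : deficit G top Y X h* H* (s 6) * suc m + (m ∸ s 7 0) ≤ n * (n + n) * suc m + m
      k≤ = ℕ.+-mono-≤ (ℕ.*-monoˡ-≤ (suc m) (∑-bounded (λ u → ℕ.≤-trans (ℕ.m∸n≤m (h* u) (heights (s 6) u)) (h*≤ u)))) (ℕ.m∸n≤m m (s 7 0))

array-toList : ∀ {A : Set} {k} (f : A → ℕ) (xs : Vec A k) i → array (toList (Vec.map f xs)) (toℕ i) ≡ f (lookup xs i)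
array-toList f (x ∷ xs) zero    = refl
array-toList f (x ∷ xs) (suc i) = array-toList f xs i

-- Polynomial bounds

data Polynomial : Set where
  const     : ℕ → Polynomial
  #n #m     : Polynomial
  _+ᵖ_ _*ᵖ_ : Polynomial → Polynomial → Polynomial

infixl 6 _+ᵖ_
infixl 7 _*ᵖ_

⟦_⟧ : Polynomial → ℕ → ℕ → ℕ
⟦ const c ⟧ n m = c
⟦ #n ⟧      n m = n
⟦ #m ⟧      n m = m
⟦ P +ᵖ Q ⟧  n m = ⟦ P ⟧ n m + ⟦ Q ⟧ n m
⟦ P *ᵖ Q ⟧  n m = ⟦ P ⟧ n m * ⟦ Q ⟧ n m

-- The coefficient is the value at n = m = 1. Adding the degrees in a sum, where the maximum would
-- do, is crude but harmless, because n + m is at least 1 and its powers are monotone.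
coefficient degree : Polynomial → ℕ
coefficient (const c) = c
coefficient #n        = 1
coefficient #m        = 1
coefficient (P +ᵖ Q)  = coefficient P + coefficient Q
coefficient (P *ᵖ Q)  = coefficient P * coefficient Q
degree (const c) = 0
degree #n        = 1
degree #m        = 1
degree (P +ᵖ Q)  = degree P + degree Q
degree (P *ᵖ Q)  = degree P + degree Q

polynomial≤monomial : ∀ P n m → 1 ≤ n + m → ⟦ P ⟧ n m ≤ coefficient P * (n + m) ^ degree P
polynomial≤monomial (const c) n m 1≤ = ℕ.≤-reflexive (sym (ℕ.*-identityʳ c))
polynomial≤monomial #n n m 1≤ rewrite ℕ.+-identityʳ ((n + m) * 1) | ℕ.*-identityʳ (n + m) = ℕ.m≤m+n n m
polynomial≤monomial #m n m 1≤ rewrite ℕ.+-identityʳ ((n + m) * 1) | ℕ.*-identityʳ (n + m) = ℕ.m≤n+m m n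
polynomial≤monomial (P +ᵖ Q) n m 1≤ = begin
  ⟦ P ⟧ n m + ⟦ Q ⟧ n m
    ≤⟨ ℕ.+-mono-≤ (polynomial≤monomial P n m 1≤) (polynomial≤monomial Q n m 1≤) ⟩
  coefficient P * N ^ degree P + coefficient Q * N ^ degree Q
    ≤⟨ ℕ.+-mono-≤ (ℕ.*-monoʳ-≤ (coefficient P) (power-mono (ℕ.m≤m+n (degree P) (degree Q))))
                  (ℕ.*-monoʳ-≤ (coefficient Q) (power-mono (ℕ.m≤n+m (degree Q) (degree P)))) ⟩
  coefficient P * N ^ (degree P + degree Q) + coefficient Q * N ^ (degree P + degree Q)
    ≡⟨ sym (ℕ.*-distribʳ-+ _ (coefficient P) (coefficient Q)) ⟩
  (coefficient P + coefficient Q) * N ^ (degree P + degree Q) ∎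
  where
  open ℕ.≤-Reasoning
  N : ℕ
  N = n + m
  power-mono : ∀ {k l} → k ≤ l → N ^ k ≤ N ^ l
  power-mono = ℕ.^-monoʳ-≤ N ⦃ ℕ.>-nonZero 1≤ ⦄
polynomial≤monomial (P *ᵖ Q) n m 1≤ = begin
  ⟦ P ⟧ n m * ⟦ Q ⟧ n m
    ≤⟨ ℕ.*-mono-≤ (polynomial≤monomial P n m 1≤) (polynomial≤monomial Q n m 1≤) ⟩
  (coefficient P * N ^ degree P) * (coefficient Q * N ^ degree Q)
    ≡⟨ rearrange (coefficient P) (N ^ degree P) (coefficient Q) (N ^ degree Q) ⟩
  (coefficient P * coefficient Q) * (N ^ degree P * N ^ degree Q)
    ≡⟨ cong ((coefficient P * coefficient Q) *_) (sym (ℕ.^-distribˡ-+-* N (degree P) (degree Q))) ⟩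
  (coefficient P * coefficient Q) * N ^ (degree P + degree Q) ∎
  where
  open ℕ.≤-Reasoning
  N : ℕ
  N = n + m
  rearrange : ∀ a b c d → (a * b) * (c * d) ≡ (a * c) * (b * d)
  rearrange = ℕSolver.solve-∀

-- Mirrors `whileBound`, so that the polynomial evaluates to the proved time bound by computation.
whilePolynomial : Expr → Polynomial → Polynomial → Polynomial
whilePolynomial b T k = const (suc (cost b)) +ᵖ k *ᵖ (const (suc (cost b)) +ᵖ T)

runningTime : Polynomial
runningTime = whilePolynomial (edges ⊖ edge) (const 50) (#n *ᵖ (#n +ᵖ #n) *ᵖ (const 1 +ᵖ #m) +ᵖ #m) +ᵖ
  whilePolynomial (vertices ⊖ vertex)
    (const 50 +ᵖ whilePolynomial (edges ⊖ edge) (const 50) (((#n +ᵖ #n) *ᵖ #n +ᵖ #n) *ᵖ (const 1 +ᵖ #m) +ᵖ #m))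
    (#n *ᵖ (#n +ᵖ #n) +ᵖ #n)

runningTime≡ : ∀ n m → relaxBound n m + flipAllBound n m ≡ ⟦ runningTime ⟧ n m
runningTime≡ n m = refl

solve : ∀ {n m : ℕ} (G : Graph n m) (top : Fin n) (X Y : Orientation m) →
  Connected G →
  (δ : Directions G) (c : Cycle G → ℕ) →
  IsCOrientation δ c X → IsCOrientation δ c Y → Acyclic G Y →
  Halts shortestFlips (input G top X Y) (relaxBound n m + flipAllBound n m)
    (λ s → ∃[ vs ] IsShortestFlipSequence G top X Y vs × Outputs s vs)
solve {n} {m} G top X Y connected δ c cX cY acyclic
  with height X Y connected top δ c cX cY | rank Y acyclic
... | h* , H* , h*≤ | a , a<n , a-decreasing =
  shortestFlips-halts G top Y a a<n a-decreasing X h* H* h*≤ connected record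
    { loaded    = record
      { vertexCount = refl
      ; edgeCount   = refl
      ; topVertex   = refl
      ; firstEnd    = array-toList _ G
      ; secondEnd   = array-toList _ G
      ; goal        = array-toList bit Y
      }
    ; start     = array-toList bit X
    ; noOutput  = refl
    ; atZero    = refl
    ; below     = λ _ → z≤n
    ; satisfied = λ _ ()
    ; measure   = refl
    }

theorem6 : Σ[ p ∈ Program ] ∃[ a ] ∃[ k ]
    (∀ {n m : ℕ} (G : Graph n m) (top : Fin n) (X Y : Orientation m) →
    Connected G →
    (δ : Directions G) (c : Cycle G → ℕ) →
    IsCOrientation δ c X → IsCOrientation δ c Y →
    Acyclic G X → Acyclic G Y →
    ∃[ vs ] (IsShortestFlipSequence G top X Y vs ×
    (∃[ s ] ∃[ t ]
    (⟨ p , input G top X Y ⟩⇓⟨ s , t ⟩ × Outputs s vs ×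
    t ≤ a * (n + m) ^ k))))
theorem6 = shortestFlips , coefficient runningTime , degree runningTime ,
  λ {n} {m} G top X Y connected δ c cX cY _ acyclic →
    answer (solve G top X Y connected δ c cX cY acyclic)
      (ℕ.≤-trans (ℕ.≤-reflexive (runningTime≡ n m)) (polynomial≤monomial runningTime n m (nonEmpty top)))
  where
  answer : ∀ {A : Set} {Q : A → Set} {R : Store → A → Set} {p s T U} →
           Halts p s T (λ s′ → ∃[ x ] Q x × R s′ x) → T ≤ U →
           ∃[ x ] (Q x × (∃[ s′ ] ∃[ t ] (⟨ p , s ⟩⇓⟨ s′ , t ⟩ × R s′ x × t ≤ U)))
  answer (halts run time≤ (x , q , r)) T≤U = x , q , _ , _ , run , r , ℕ.≤-trans time≤ T≤U

  nonEmpty : ∀ {n m} → Fin n → 1 ≤ n + m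
  nonEmpty top = ℕ.≤-trans (ℕ.≤-trans (s≤s z≤n) (Fin.toℕ<n top)) (ℕ.m≤m+n _ _)
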